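{- For a nonempty partition $\lambda$, define the weight $\omega(\lambda)=1+4\sum_j(-1)^j$, where the sum is over those $j$ in the initial run of $\lambda$ that occur an odd number of times as a part of $\lambda$. Then for every positive integer $n$, $$M_e(n)-M_o(n)=\sum_{\lambda}\omega(\lambda),$$ the sum being over all partitions $\lambda$ of $n$.
   Context: The initial run of a partition $\lambda$ is the set $\{1,2,\dots,r\}$ where $r\ge 0$ is the largest integer such that each of $1,2,\dots,r$ occurs as a part of $\lambda$ (empty if $1$ is not a part). For example $(7,7,5,3,3,3,3,2,1,1)$ has initial run $\{1,2,3\}$. For $|q|<1$ write $(z;q)_\infty=\prod_{j\geq 0}(1-zq^j)$; $M_e(n)-M_o(n)$ (even-crank minus odd-crank partitions of $n$, Andrews–Garvan crank) is defined by $\sum_{n\geq 0}(M_e(n)-M_o(n))q^n=\frac{(q;q)_\infty}{(-q;q)_\infty^2}$. -}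

module Defs where

open import Data.Bool using (if_then_else_)
open import Data.Integer as ℤ using (ℤ; +_; 0ℤ; 1ℤ; -1ℤ)
import Data.Integer.Properties as ℤ
open import Data.List using (List; []; _∷_; _++_; map; length; filter; foldr; replicate; concatMap; zipWith; upTo)
open import Data.List.Properties using (++-cancelˡ; ∷-injectiveʳ; map-applyUpTo)
open import Data.List.Membership.Propositional using (_∈_; find; lose)
open import Data.List.Membership.Propositional.Properties using (∈-concatMap⁺; ∈-concatMap⁻; ∈-map⁺; ∈-map⁻; ∈-upTo⁺; ∈-upTo⁻)
open import Data.List.Relation.Unary.All as All using (All; []; _∷_; all?)
import Data.List.Relation.Unary.All.Properties as All
open import Data.List.Relation.Unary.AllPairs as AllPairs using (AllPairs; []; _∷_)
import Data.List.Relation.Unary.AllPairs.Properties as AllPairs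
open import Data.List.Relation.Unary.Any using (here; there)
open import Data.List.Relation.Unary.Linked as Linked using (Linked; []; [-]; _∷_)
open import Data.List.Relation.Unary.Linked.Properties using (Linked⇒AllPairs)
open import Data.List.Relation.Unary.Unique.Propositional using (Unique)
import Data.List.Relation.Unary.Unique.Propositional.Properties as Unique
open import Data.Nat as ℕ using (ℕ; zero; suc; _≤_; _<_; _≥_; _∸_; _/_; _%_; z≤n; s≤s; _≡ᵇ_)
import Data.Nat.DivMod as ℕ
open import Data.Nat.ListAction using (sum)
import Data.Nat.Properties as ℕ
open import Data.List.Membership.DecPropositional ℕ._≟_ using (_∈?_)
open import Data.Product using (_×_; _,_; ∃; proj₁; proj₂)
open import Data.Sum using (inj₁; inj₂)
open import Data.Empty using (⊥-elim)
open import Function using (_∘_)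
open import Relation.Binary.PropositionalEquality using (_≡_; refl; sym; trans; cong; cong₂; subst; module ≡-Reasoning)
open import Relation.Nullary using (Dec; yes; no; ¬_)

sumℤ : List ℤ → ℤ
sumℤ = foldr ℤ._+_ 0ℤ

-- Formal power series in q over ℤ; f n is the coefficient of qⁿ.
Series : Set
Series = ℕ → ℤ

infixl 6 _⊝_
infixl 7 _⊛_
infix 4 _≐_

_≐_ : Series → Series → Set
f ≐ g = ∀ n → f n ≡ g n

q^ : ℕ → Series
q^ j n = if n ≡ᵇ j then 1ℤ else 0ℤ

𝟙 : Series
𝟙 = q^ 0

_⊝_ : Series → Series → Series
(f ⊝ g) n = f n ℤ.- g n

neg : Series → Series
neg f n = ℤ.- f n

_⊛_ : Series → Series → Series
(f ⊛ g) n = sumℤ (map (λ k → f k ℤ.* g (n ∸ k)) (upTo (suc n)))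

-- (z ; q)_N = ∏_{0 ≤ j < N} (1 − z q^j), with z itself a series in q.
poch : Series → ℕ → Series
poch z zero    = 𝟙
poch z (suc N) = (𝟙 ⊝ z ⊛ q^ N) ⊛ poch z N

-- (z ; q)_∞, for z without constant term: the coefficient of qⁿ in
-- (z ; q)_N is then the same for all N ≥ n (poch-stable).
poch∞ : Series → Series
poch∞ z n = poch z n n

-- The multiplicative inverse of a series with constant term 1 (recip-inverse),
-- by  b₀ = 1,  b_{n+1} = − Σ_{k ≤ n} g_{k+1} b_{n−k}.
-- recipPrefix g n is the list b_n , b_{n−1} , … , b₀.
recipNext : Series → ℕ → List ℤ → ℤ
recipNext g n bs = ℤ.- sumℤ (zipWith ℤ._*_ (map (g ∘ suc) (upTo (suc n))) bs)

recipPrefix : Series → ℕ → List ℤ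
recip       : Series → Series

recipPrefix g zero    = recip g zero ∷ []
recipPrefix g (suc n) = recip g (suc n) ∷ recipPrefix g n

recip g zero    = 1ℤ
recip g (suc n) = recipNext g n (recipPrefix g n)

-- M_e(n) − M_o(n): the coefficient of qⁿ in (q;q)_∞ / (−q;q)_∞².
Mₑ-Mₒ : ℕ → ℤ
Mₑ-Mₒ = poch∞ (q^ 1) ⊛ recip (poch∞ (neg (q^ 1)) ⊛ poch∞ (neg (q^ 1)))

record _⊢_ (xs : List ℕ) (n : ℕ) : Set where
  constructor mk⊢
  field
    decreasing : Linked _≥_ xs
    positive   : All (0 <_) xs
    total      : sum xs ≡ n

-- All partitions of n with parts ≤ m; k is the multiplicity of the largest allowed part.
partitions≤ : ℕ → ℕ → List (List ℕ)
partitions≤ zero    zero    = [] ∷ []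
partitions≤ zero    (suc n) = []
partitions≤ (suc m) n       =
  concatMap (λ k → map (replicate k (suc m) ++_) (partitions≤ m (n ∸ k ℕ.* suc m)))
            (upTo (suc (n / suc m)))

-- Each partition of n exactly once (partitions-sound, -complete, -unique).
partitions : ℕ → List (List ℕ)
partitions n = partitions≤ n n

[1‥_] : ℕ → List ℕ
[1‥ r ] = map suc (upTo r)

HasRun : List ℕ → ℕ → Set
HasRun xs r = All (_∈ xs) [1‥ r ]

hasRun? : ∀ xs r → Dec (HasRun xs r)
hasRun? xs r = all? (_∈? xs) [1‥ r ]

greatestRun≤ : List ℕ → ℕ → ℕ
greatestRun≤ xs zero = zero
greatestRun≤ xs (suc b) with hasRun? xs (suc b)
... | yes _ = suc b
... | no  _ = greatestRun≤ xs b

-- The largest r with HasRun xs r (runLength-hasRun, runLength-greatest);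
-- a part cannot exceed the sum of all parts.
runLength : List ℕ → ℕ
runLength xs = greatestRun≤ xs (sum xs)

initialRun : List ℕ → List ℕ
initialRun xs = [1‥ runLength xs ]

multiplicity : ℕ → List ℕ → ℕ
multiplicity j xs = length (filter (ℕ._≟ j) xs)

OccursOddly : List ℕ → ℕ → Set
OccursOddly xs j = multiplicity j xs % 2 ≡ 1

occursOddly? : ∀ xs j → Dec (OccursOddly xs j)
occursOddly? xs j = multiplicity j xs % 2 ℕ.≟ 1

ω : List ℕ → ℤ
ω xs = 1ℤ ℤ.+ + 4 ℤ.* sumℤ (map (-1ℤ ℤ.^_) (filter (occursOddly? xs) (initialRun xs)))

greatestRun≤-hasRun : ∀ xs b → HasRun xs (greatestRun≤ xs b)
greatestRun≤-hasRun xs zero = []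
greatestRun≤-hasRun xs (suc b) with hasRun? xs (suc b)
... | yes p = p
... | no  _ = greatestRun≤-hasRun xs b

greatestRun≤-greatest : ∀ xs b {s} → s ≤ b → HasRun xs s → s ≤ greatestRun≤ xs b
greatestRun≤-greatest xs zero s≤b _ = s≤b
greatestRun≤-greatest xs (suc b) s≤b h with hasRun? xs (suc b)
... | yes _ = s≤b
... | no ¬p with ℕ.m≤n⇒m<n∨m≡n s≤b
...   | inj₁ (s≤s s≤b′) = greatestRun≤-greatest xs b s≤b′ h
...   | inj₂ refl       = ⊥-elim (¬p h)

∈⇒≤sum : ∀ {j} xs → j ∈ xs → j ≤ sum xs
∈⇒≤sum (x ∷ xs) (here refl) = ℕ.m≤m+n x (sum xs)
∈⇒≤sum (x ∷ xs) (there p)   = ℕ.≤-trans (∈⇒≤sum xs p) (ℕ.m≤n+m (sum xs) x)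

hasRun⇒≤sum : ∀ xs r → HasRun xs r → r ≤ sum xs
hasRun⇒≤sum xs zero    _ = z≤n
hasRun⇒≤sum xs (suc r) h = ∈⇒≤sum xs (All.lookup h (∈-map⁺ suc (∈-upTo⁺ (ℕ.n<1+n r))))

runLength-hasRun : ∀ xs → HasRun xs (runLength xs)
runLength-hasRun xs = greatestRun≤-hasRun xs (sum xs)

runLength-greatest : ∀ xs s → HasRun xs s → s ≤ runLength xs
runLength-greatest xs s h = greatestRun≤-greatest xs (sum xs) (hasRun⇒≤sum xs s h) h

sum-replicate-++ : ∀ k a ys → sum (replicate k a ++ ys) ≡ k ℕ.* a ℕ.+ sum ys
sum-replicate-++ zero    a ys = refl
sum-replicate-++ (suc k) a ys = trans (cong (a ℕ.+_) (sum-replicate-++ k a ys)) (sym (ℕ.+-assoc a (k ℕ.* a) (sum ys)))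

all-replicate-++ : ∀ {P : ℕ → Set} k {a ys} → P a → All P ys → All P (replicate k a ++ ys)
all-replicate-++ zero    p ps = ps
all-replicate-++ (suc k) p ps = p ∷ all-replicate-++ k p ps

linked-cons : ∀ {a ys} → All (_≤ a) ys → Linked _≥_ ys → Linked _≥_ (a ∷ ys)
linked-cons []      []  = [-]
linked-cons (p ∷ _) l   = p ∷ l

linked-replicate-++ : ∀ k {a ys} → All (_≤ a) ys → Linked _≥_ ys → Linked _≥_ (replicate k a ++ ys)
linked-replicate-++ zero    ps l = l
linked-replicate-++ (suc k) ps l = linked-cons (all-replicate-++ k ℕ.≤-refl ps) (linked-replicate-++ k ps l)

∈-partitions≤-suc⁻ : ∀ m n {xs} → xs ∈ partitions≤ (suc m) n →
  ∃ λ k → ∃ λ ys → k ℕ.* suc m ≤ n × ys ∈ partitions≤ m (n ∸ k ℕ.* suc m) × xs ≡ replicate k (suc m) ++ ys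
∈-partitions≤-suc⁻ m n p
  with find (∈-concatMap⁻ (λ k → map (replicate k (suc m) ++_) (partitions≤ m (n ∸ k ℕ.* suc m))) {xs = upTo (suc (n / suc m))} p)
... | k , k∈ , q with ∈-map⁻ _ q
...   | ys , ys∈ , eq = k , ys , ℕ.≤-trans (ℕ.*-monoˡ-≤ (suc m) (ℕ.s≤s⁻¹ (∈-upTo⁻ k∈))) (ℕ.m/n*n≤m n (suc m)) , ys∈ , eq

∈-partitions≤-suc⁺ : ∀ m n k {ys} → k ℕ.* suc m ≤ n → ys ∈ partitions≤ m (n ∸ k ℕ.* suc m) →
  replicate k (suc m) ++ ys ∈ partitions≤ (suc m) n
∈-partitions≤-suc⁺ m n k {ys} k≤ ys∈ =
  ∈-concatMap⁺ _ (lose (∈-upTo⁺ (s≤s k≤′)) (∈-map⁺ (replicate k (suc m) ++_) ys∈))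
  where
  k≤′ : k ≤ n / suc m
  k≤′ = subst (_≤ n / suc m) (ℕ.m*n/n≡m k (suc m)) (ℕ./-monoˡ-≤ (suc m) k≤)

partitions≤-sound : ∀ m n {xs} → xs ∈ partitions≤ m n → xs ⊢ n × All (_≤ m) xs
partitions≤-sound zero zero (here refl) = mk⊢ [] [] refl , []
partitions≤-sound (suc m) n p with ∈-partitions≤-suc⁻ m n p
... | k , ys , k≤ , ys∈ , refl with partitions≤-sound m (n ∸ k ℕ.* suc m) ys∈
...   | mk⊢ dec pos tot , ≤m =
  mk⊢ (linked-replicate-++ k ≤1+m dec) (all-replicate-++ k (s≤s z≤n) pos)
      (trans (sum-replicate-++ k (suc m) ys) (trans (cong (k ℕ.* suc m ℕ.+_) tot) (ℕ.m+[n∸m]≡n k≤)))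
  , all-replicate-++ k ℕ.≤-refl ≤1+m
  where
  ≤1+m : All (_≤ suc m) ys
  ≤1+m = All.map ℕ.m≤n⇒m≤1+n ≤m

split-replicate : ∀ m xs → Linked _≥_ xs → All (0 <_) xs → All (_≤ suc m) xs →
  ∃ λ k → ∃ λ ys → xs ≡ replicate k (suc m) ++ ys × Linked _≥_ ys × All (0 <_) ys × All (_≤ m) ys
split-replicate m []       l p b = 0 , [] , refl , [] , [] , []
split-replicate m (x ∷ xs) l (p ∷ ps) (b ∷ bs) with ℕ.m≤n⇒m<n∨m≡n b
... | inj₁ (s≤s x≤m) = 0 , x ∷ xs , refl , l , p ∷ ps ,
  x≤m ∷ All.map (λ y≤x → ℕ.≤-trans y≤x x≤m) (AllPairs.head (Linked⇒AllPairs (λ a b → ℕ.≤-trans b a) l))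
... | inj₂ refl with split-replicate m xs (Linked.tail l) ps bs
...   | k , ys , eq , rest = suc k , ys , cong (suc m ∷_) eq , rest

partitions≤-complete : ∀ m n {xs} → xs ⊢ n → All (_≤ m) xs → xs ∈ partitions≤ m n
partitions≤-complete zero n {[]} (mk⊢ _ _ refl) _ = here refl
partitions≤-complete zero n {x ∷ xs} (mk⊢ _ (p ∷ _) _) (b ∷ _) = ⊥-elim (ℕ.<⇒≱ p b)
partitions≤-complete (suc m) n {xs} (mk⊢ dec pos tot) b with split-replicate m xs dec pos b
... | k , ys , refl , dec′ , pos′ , b′ =
  ∈-partitions≤-suc⁺ m n k (subst (k ℕ.* suc m ≤_) eq (ℕ.m≤m+n _ (sum ys)))
    (partitions≤-complete m (n ∸ k ℕ.* suc m)
      (mk⊢ dec′ pos′ (trans (sym (ℕ.m+n∸m≡n (k ℕ.* suc m) (sum ys))) (cong (_∸ k ℕ.* suc m) eq))) b′)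
  where
  eq : k ℕ.* suc m ℕ.+ sum ys ≡ n
  eq = trans (sym (sum-replicate-++ k (suc m) ys)) tot

replicate-++-injective : ∀ {m} k l {ys zs} → All (_≤ m) ys → All (_≤ m) zs →
  replicate k (suc m) ++ ys ≡ replicate l (suc m) ++ zs → k ≡ l
replicate-++-injective zero    zero    _ _ _ = refl
replicate-++-injective zero    (suc l) (p ∷ _) _ refl = ⊥-elim (ℕ.1+n≰n p)
replicate-++-injective (suc k) zero    _ (p ∷ _) refl = ⊥-elim (ℕ.1+n≰n p)
replicate-++-injective (suc k) (suc l) ps qs eq = cong suc (replicate-++-injective k l ps qs (∷-injectiveʳ eq))

partitions≤-unique : ∀ m n → Unique (partitions≤ m n)
partitions≤-unique zero    zero    = [] ∷ []
partitions≤-unique zero    (suc n) = []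
partitions≤-unique (suc m) n =
  Unique.concat⁺
    (All.map⁺ (All.universal (λ k → Unique.map⁺ (++-cancelˡ (replicate k (suc m)) _ _) (partitions≤-unique m (n ∸ k ℕ.* suc m))) (upTo (suc (n / suc m)))))
    (AllPairs.map⁺ (AllPairs.map disjoint (Unique.upTo⁺ (suc (n / suc m)))))
  where
  block : ℕ → List (List ℕ)
  block k = map (replicate k (suc m) ++_) (partitions≤ m (n ∸ k ℕ.* suc m))
  disjoint : ∀ {k l} → ¬ k ≡ l → ∀ {xs} → ¬ (xs ∈ block k × xs ∈ block l)
  disjoint {k} {l} k≢l (p , q) with ∈-map⁻ _ p | ∈-map⁻ _ q
  ... | ys , ys∈ , refl | zs , zs∈ , eq =
    k≢l (replicate-++-injective k l (proj₂ (partitions≤-sound m _ ys∈)) (proj₂ (partitions≤-sound m _ zs∈)) eq)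

partitions-sound : ∀ n {xs} → xs ∈ partitions n → xs ⊢ n
partitions-sound n p = proj₁ (partitions≤-sound n n p)

partitions-complete : ∀ n {xs} → xs ⊢ n → xs ∈ partitions n
partitions-complete n {xs} h@(mk⊢ _ _ refl) = partitions≤-complete n n h (All.tabulate (∈⇒≤sum xs))

partitions-unique : ∀ n → Unique (partitions n)
partitions-unique n = partitions≤-unique n n

sumℤ-zero : ∀ {A : Set} (f : A → ℤ) {xs} → All (λ x → f x ≡ 0ℤ) xs → sumℤ (map f xs) ≡ 0ℤ
sumℤ-zero f []       = refl
sumℤ-zero f (p ∷ ps) = cong₂ ℤ._+_ p (sumℤ-zero f ps)

map-upTo-suc : ∀ {A : Set} (f : ℕ → A) n → map f (upTo (suc n)) ≡ f 0 ∷ map (f ∘ suc) (upTo n)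
map-upTo-suc f n = cong (f 0 ∷_) (trans (map-applyUpTo suc f n) (sym (map-applyUpTo (λ i → i) (f ∘ suc) n)))

recipPrefix≡ : ∀ g n → recipPrefix g n ≡ map (λ k → recip g (n ∸ k)) (upTo (suc n))
recipPrefix≡ g zero    = refl
recipPrefix≡ g (suc n) = trans (cong (recip g (suc n) ∷_) (recipPrefix≡ g n)) (sym (map-upTo-suc _ (suc n)))

zipWith-map : ∀ (f h : ℕ → ℤ) xs → zipWith ℤ._*_ (map f xs) (map h xs) ≡ map (λ k → f k ℤ.* h k) xs
zipWith-map f h []       = refl
zipWith-map f h (x ∷ xs) = cong (_ ∷_) (zipWith-map f h xs)

recip-inverse : ∀ g → g 0 ≡ 1ℤ → g ⊛ recip g ≐ 𝟙
recip-inverse g g0 zero    rewrite g0 = refl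
recip-inverse g g0 (suc n) = begin
  sumℤ (map F (upTo (suc (suc n))))                       ≡⟨ cong sumℤ (map-upTo-suc F (suc n)) ⟩
  g 0 ℤ.* recip g (suc n) ℤ.+ S                           ≡⟨ cong (λ x → x ℤ.* recip g (suc n) ℤ.+ S) g0 ⟩
  1ℤ ℤ.* recip g (suc n) ℤ.+ S                            ≡⟨ cong (ℤ._+ S) (ℤ.*-identityˡ (recip g (suc n))) ⟩
  recip g (suc n) ℤ.+ S                                   ≡⟨ cong (λ x → ℤ.- sumℤ x ℤ.+ S) eq ⟩
  ℤ.- S ℤ.+ S                                             ≡⟨ ℤ.+-inverseˡ S ⟩
  0ℤ ∎
  where
  open ≡-Reasoning
  F : ℕ → ℤ
  F k = g k ℤ.* recip g (suc n ∸ k)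
  S : ℤ
  S = sumℤ (map (F ∘ suc) (upTo (suc n)))
  eq : zipWith ℤ._*_ (map (g ∘ suc) (upTo (suc n))) (recipPrefix g n) ≡ map (F ∘ suc) (upTo (suc n))
  eq = trans (cong (zipWith ℤ._*_ (map (g ∘ suc) (upTo (suc n)))) (recipPrefix≡ g n))
             (zipWith-map (g ∘ suc) (λ k → recip g (n ∸ k)) (upTo (suc n)))

denominator-constant : (poch∞ (neg (q^ 1)) ⊛ poch∞ (neg (q^ 1))) 0 ≡ 1ℤ
denominator-constant = refl

q^-below : ∀ {j n} → n < j → q^ j n ≡ 0ℤ
q^-below {suc j} {zero}  _       = refl
q^-below {suc j} {suc n} (s≤s p) = q^-below p

shift-below : ∀ z → z 0 ≡ 0ℤ → ∀ j n → n ≤ j → (z ⊛ q^ j) n ≡ 0ℤ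
shift-below z z0 j n n≤j = sumℤ-zero (λ k → z k ℤ.* q^ j (n ∸ k)) (All.tabulate (λ {k} k∈ → term k (ℕ.s≤s⁻¹ (∈-upTo⁻ k∈))))
  where
  term : ∀ k → k ≤ n → z k ℤ.* q^ j (n ∸ k) ≡ 0ℤ
  term zero    _   rewrite z0 = refl
  term (suc k) k≤n = trans (cong (z (suc k) ℤ.*_) (q^-below (ℕ.<-≤-trans (ℕ.∸-monoʳ-< (s≤s z≤n) k≤n) n≤j))) (ℤ.*-zeroʳ (z (suc k)))

poch-step : ∀ z → z 0 ≡ 0ℤ → ∀ N n → n ≤ N → poch z (suc N) n ≡ poch z N n
poch-step z z0 N n n≤N = begin
  sumℤ (map F (upTo (suc n)))                   ≡⟨ cong sumℤ (map-upTo-suc F n) ⟩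
  F 0 ℤ.+ sumℤ (map (F ∘ suc) (upTo n))         ≡⟨ cong₂ ℤ._+_ first (sumℤ-zero (F ∘ suc) (All.tabulate (λ {k} k∈ → rest k (∈-upTo⁻ k∈)))) ⟩
  poch z N n ℤ.+ 0ℤ                             ≡⟨ ℤ.+-identityʳ _ ⟩
  poch z N n ∎
  where
  open ≡-Reasoning
  F : ℕ → ℤ
  F k = (𝟙 ⊝ z ⊛ q^ N) k ℤ.* poch z N (n ∸ k)
  first : F 0 ≡ poch z N n
  first = trans (cong (λ x → (1ℤ ℤ.- x) ℤ.* poch z N n) (shift-below z z0 N 0 z≤n)) (ℤ.*-identityˡ _)
  rest : ∀ k → k < n → F (suc k) ≡ 0ℤ
  rest k k<n = cong (λ x → (0ℤ ℤ.- x) ℤ.* poch z N (n ∸ suc k)) (shift-below z z0 N (suc k) (ℕ.≤-trans k<n n≤N))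

poch-stable : ∀ z → z 0 ≡ 0ℤ → ∀ n d → poch z (d ℕ.+ n) n ≡ poch∞ z n
poch-stable z z0 n zero    = refl
poch-stable z z0 n (suc d) = trans (poch-step z z0 (d ℕ.+ n) n (ℕ.m≤n+m n d)) (poch-stable z z0 n d)

{-# OPTIONS --safe #-}

-- Splitting off the copies of the largest part gives
--   Σ_λ ω(λ) q^|λ| = (1/(q;q)_∞) (1 + 4 Σ_{j≥1} (−1)^j q^(j(j+1)/2) / (1 + q^j)),
-- so the claim is that the bracket equals (q;q)²_∞ / (−q;q)²_∞.  This is the limit of
--   1/(−q;q)²_N = 1/(q;q)²_N
--     + 4 Σ_{j=1}^N (−1)^j q^(j(j+1)/2) / ((1 + q^j) (q;q)_{N−j} (q;q)_{N+j}),
-- proved by induction on N: (1 + q^N)² times the summand for N, minus the summand for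
-- N − 1, is a telescoping difference in j.  Modulo q^(N+1) the factors (q;q)_{N−j} and
-- (q;q)_{N+j} may both be replaced by (q;q)_N, since q^(j(j+1)/2) is divisible by q^j.
-- The coefficient of q^n is therefore computed in the ring ℤ[[q]]/(q^(n+1)).

module Submission where

open import Defs
open import Algebra using (CommutativeRing)
import Algebra.Properties.Ring
import Algebra.Solver.Ring
open import Algebra.Solver.Ring.AlmostCommutativeRing using (fromCommutativeRing; _-Raw-AlmostCommutative⟶_)
open import Data.Bool using (if_then_else_)
open import Data.Empty using (⊥-elim)
open import Data.Integer as ℤ using (ℤ; +_; 0ℤ; 1ℤ; -1ℤ)
import Data.Integer.Properties as ℤ
open import Data.Integer.Tactic.RingSolver using (solve-∀)
open import Data.List using (List; []; _∷_; [_]; _++_; map; length; filter; replicate; concatMap; upTo)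
open import Data.List.Properties using (map-cong; map-cong-local; map-++; map-∘; filter-++; filter-none; filter-accept; filter-reject; upTo-∷ʳ)
open import Data.List.Membership.Propositional using (_∈_)
open import Data.List.Membership.Propositional.Properties using (∈-map⁺; ∈-upTo⁺; ∈-upTo⁻; ∈-++⁺ʳ)
open import Data.List.Relation.Unary.All as All using (All)
import Data.List.Relation.Unary.All.Properties as All
open import Data.List.Relation.Unary.Any using (here; there)
import Data.Maybe as Maybe
open import Data.Nat as ℕ using (ℕ; zero; suc; _≤_; _<_; _∸_; _/_; _%_; z≤n; s≤s)
import Data.Nat.DivMod as ℕ
import Data.Nat.Properties as ℕ
open import Data.Product using (_,_; proj₂)
open import Data.Sum using (inj₁; inj₂)
open import Function using (_∘_)
open import Level using (0ℓ; _⊔_)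
open import Relation.Binary.PropositionalEquality as ≡ using (_≡_)
import Relation.Binary.Reasoning.Setoid
open import Relation.Nullary using (¬_; does; yes; no)
open import Relation.Nullary.Decidable using (dec⇒maybe; dec-true; dec-false)

-- The finite identity over an abstract commutative ring.

record InvertibleFactors {c ℓ} (R : CommutativeRing c ℓ) : Set (c ⊔ ℓ) where
  open CommutativeRing R
  field
    pow       : ℕ → Carrier
    pow-0     : pow 0 ≈ 1#
    pow-+     : ∀ m n → pow (m ℕ.+ n) ≈ pow m * pow n
    α β       : ℕ → Carrier
    α-inverse : ∀ k → (1# - pow (suc k)) * α k ≈ 1#
    β-inverse : ∀ k → (1# + pow (suc k)) * β k ≈ 1#

-- Here `pow k` stands for q^k, and `α k` and `β k` for 1/(1 - q^(k+1)) and 1/(1 + q^(k+1)). The map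
-- `ℤ⟶R` supplies the ring solver with integer coefficients.
module FiniteIdentity {c ℓ} (R : CommutativeRing c ℓ)
  (ℤ⟶R : CommutativeRing.rawRing ℤ.+-*-commutativeRing -Raw-AlmostCommutative⟶ fromCommutativeRing R)
  (factors : InvertibleFactors R)
  where

  open CommutativeRing R
  open InvertibleFactors factors
  open Algebra.Solver.Ring (CommutativeRing.rawRing ℤ.+-*-commutativeRing) (fromCommutativeRing R) ℤ⟶R
    (λ a b → Maybe.map (λ a≡b → reflexive (≡.cong (_-Raw-AlmostCommutative⟶_.⟦_⟧ ℤ⟶R) a≡b)) (dec⇒maybe (a ℤ.≟ b)))
  open Algebra.Properties.Ring ring using (-0#≈0#)
  open Relation.Binary.Reasoning.Setoid setoid

  -- con 1ℤ denotes the image of 1ℤ, which is not 1# on the nose, but a zeroth power is.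
  :1 : ∀ {n} → Polynomial n
  :1 = con 1ℤ :^ 0

  4# : Carrier
  4# = 1# + 1# + 1# + 1#

  :4 : ∀ {n} → Polynomial n
  :4 = :1 :+ :1 :+ :1 :+ :1

  ∑ : (ℕ → Carrier) → ℕ → Carrier
  ∑ f zero    = 0#
  ∑ f (suc n) = ∑ f n + f n

  ∑-cong : ∀ {f g} → (∀ i → f i ≈ g i) → ∀ n → ∑ f n ≈ ∑ g n
  ∑-cong f≈g zero    = refl
  ∑-cong f≈g (suc n) = +-cong (∑-cong f≈g n) (f≈g n)

  ∑-+ : ∀ f g n → ∑ (λ i → f i + g i) n ≈ ∑ f n + ∑ g n
  ∑-+ f g zero    = sym (+-identityˡ 0#)
  ∑-+ f g (suc n) = trans (+-congʳ (∑-+ f g n))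
    (solve 4 (λ a b c d → (a :+ b) :+ (c :+ d) := (a :+ c) :+ (b :+ d)) refl (∑ f n) (∑ g n) (f n) (g n))

  ∑-*ˡ : ∀ a f n → ∑ (λ i → a * f i) n ≈ a * ∑ f n
  ∑-*ˡ a f zero    = sym (zeroʳ a)
  ∑-*ˡ a f (suc n) = trans (+-congʳ (∑-*ˡ a f n)) (sym (distribˡ a (∑ f n) (f n)))

  ∑-telescope : ∀ (g : ℕ → Carrier) n → ∑ (λ i → g i - g (suc i)) n ≈ g 0 - g n
  ∑-telescope g zero    = sym (-‿inverseʳ (g 0))
  ∑-telescope g (suc n) = trans (+-congʳ (∑-telescope g n))
    (solve 3 (λ a b c → (a :- b) :+ (b :- c) := a :- c) refl (g 0) (g n) (g (suc n)))

  -- Identities with denominators are proved by first multiplying both sides by a unit `u` that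
  -- clears them.
  cancel : ∀ {u v x y} → u * v ≈ 1# → u * x ≈ u * y → x ≈ y
  cancel {u} {v} {x} {y} uv ux≈uy = begin
    x           ≈⟨ *-identityˡ x ⟨
    1# * x      ≈⟨ *-congʳ uv ⟨
    u * v * x   ≈⟨ solve 3 (λ u v x → u :* v :* x := v :* (u :* x)) refl u v x ⟩
    v * (u * x) ≈⟨ *-congˡ ux≈uy ⟩
    v * (u * y) ≈⟨ solve 3 (λ u v x → v :* (u :* x) := u :* v :* x) refl u v y ⟩
    u * v * y   ≈⟨ *-congʳ uv ⟩
    1# * y      ≈⟨ *-identityˡ y ⟩
    y           ∎

  sgn : ℕ → Carrier
  sgn zero    = 1#
  sgn (suc j) = - sgn j

  -- q^(j(j−1)/2)
  τ : ℕ → Carrier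
  τ zero    = 1#
  τ (suc j) = pow j * τ j

  -- 1/(q;q)_n
  H : ℕ → Carrier
  H zero    = 1#
  H (suc n) = α n * H n

  -- 1/(−q;q)_n
  A : ℕ → Carrier
  A zero    = 1#
  A (suc n) = β n * A n

  -- 1/(q;q)_{n−j}, read as 0 when j > n
  E : ℕ → ℕ → Carrier
  E n       zero    = H n
  E zero    (suc j) = 0#
  E (suc n) (suc j) = E n j

  E-above : ∀ n → E n (suc n) ≈ 0#
  E-above zero    = refl
  E-above (suc n) = E-above n

  H-step : ∀ n → (1# - pow (suc n)) * H (suc n) ≈ H n
  H-step n = trans (sym (*-assoc _ (α n) (H n))) (trans (*-congʳ (α-inverse n)) (*-identityˡ (H n)))

  -- The factor pow j makes this hold also where E vanishes.
  E-step : ∀ n j → pow j * E n (suc j) ≈ (pow j - pow n) * E n j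
  E-step zero zero = trans (zeroʳ (pow 0)) (sym (trans (*-congʳ (-‿inverseʳ (pow 0))) (zeroˡ (H 0))))
  E-step zero (suc j) = trans (zeroʳ _) (sym (zeroʳ _))
  E-step (suc n) zero = begin
    pow 0 * H n                           ≈⟨ *-cong pow-0 (sym (H-step n)) ⟩
    1# * ((1# - pow (suc n)) * H (suc n)) ≈⟨ *-identityˡ _ ⟩
    (1# - pow (suc n)) * H (suc n)        ≈⟨ *-congʳ (+-congʳ pow-0) ⟨
    (pow 0 - pow (suc n)) * H (suc n)     ∎
  E-step (suc n) (suc j) = begin
    pow (suc j) * E n (suc j)                 ≈⟨ *-congʳ (pow-+ 1 j) ⟩
    pow 1 * pow j * E n (suc j)               ≈⟨ *-assoc _ _ _ ⟩
    pow 1 * (pow j * E n (suc j))             ≈⟨ *-congˡ (E-step n j) ⟩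
    pow 1 * ((pow j - pow n) * E n j)         ≈⟨ solve 4 (λ q x y e → q :* ((x :- y) :* e) := (q :* x :- q :* y) :* e) refl (pow 1) (pow j) (pow n) (E n j) ⟩
    (pow 1 * pow j - pow 1 * pow n) * E n j   ≈⟨ *-congʳ (+-cong (pow-+ 1 j) (-‿cong (pow-+ 1 n))) ⟨
    (pow (suc j) - pow (suc n)) * E n j       ∎

  -- The power is split as q^m q^(i+1), so that with x = q^m and y = q^(i+1) the factor is the
  -- polynomial 1 - xy.
  H-step-+ : ∀ m i → H (m ℕ.+ i) ≈ (1# - pow m * pow (suc i)) * H (m ℕ.+ suc i)
  H-step-+ m i = begin
    H (m ℕ.+ i)                                      ≈⟨ H-step (m ℕ.+ i) ⟨
    (1# - pow (suc (m ℕ.+ i))) * H (suc (m ℕ.+ i))   ≡⟨ ≡.cong (λ k → (1# - pow k) * H k) (ℕ.+-suc m i) ⟨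
    (1# - pow (m ℕ.+ suc i)) * H (m ℕ.+ suc i)       ≈⟨ *-congʳ (+-congˡ (-‿cong (pow-+ m (suc i)))) ⟩
    (1# - pow m * pow (suc i)) * H (m ℕ.+ suc i)     ∎

  -- The summands below are indexed by i = j − 1.

  -- (−1)^j q^(j(j+1)/2) / (1 + q^j)
  w : ℕ → Carrier
  w i = sgn (suc i) * (τ (suc (suc i)) * β i)

  -- The summand of the finite identity for N = `n` and j = i + 1, without the factor 4.
  u : ℕ → ℕ → Carrier
  u n i = w i * (E n (suc i) * H (n ℕ.+ suc i))

  -- For m = n + 1: the excess of (1 + q^m)² times the summand for m over the summand for m - 1,
  -- divided by q^m (see `u-step`).
  d : ℕ → ℕ → Carrier
  d m i = sgn (suc i) * τ (suc i) * ((1# + pow (suc i)) * (E m (suc i) * H (m ℕ.+ suc i)))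

  -- The sequence whose successive differences give (1 - q^m) `d m i`.
  g : ℕ → ℕ → Carrier
  g m i = sgn (suc i) * τ (suc i) * (E m (suc i) * H (m ℕ.+ i))

  -- y(1+x)² − (y−x)(1−xy) = x(1+y)² with x = q^(n+1), y = q^j:
  -- the factor (1+y)² cancels the denominator of w.
  u-step : ∀ n i → (1# + pow (suc n)) * (1# + pow (suc n)) * u (suc n) i ≈ u n i + pow (suc n) * d (suc n) i
  u-step n i = begin
    (1# + x) * (1# + x) * (s * (y * t * b) * (e * h))
      ≈⟨ solve 7 (λ x y s t b e h →
           (:1 :+ x) :* (:1 :+ x) :* (s :* (y :* t :* b) :* (e :* h))
           := s :* t :* b :* (((y :- x) :* e) :* ((:1 :- x :* y) :* h))
              :+ x :* (s :* t :* ((:1 :+ y) :* (e :* h))) :* ((:1 :+ y) :* b))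
           refl x y s t b e h ⟩
    s * t * b * (((y - x) * e) * ((1# - x * y) * h)) + x * (s * t * ((1# + y) * (e * h))) * ((1# + y) * b)
      ≈⟨ +-cong (*-congˡ (*-cong (E-step (suc n) (suc i)) H-shift)) (sym (trans (*-congˡ (β-inverse i)) (*-identityʳ _))) ⟨
    s * t * b * ((y * e₀) * h₀) + x * (s * t * ((1# + y) * (e * h)))
      ≈⟨ +-congʳ (solve 6 (λ y s t b e h → s :* t :* b :* ((y :* e) :* h) := s :* (y :* t :* b) :* (e :* h)) refl y s t b e₀ h₀) ⟩
    s * (y * t * b) * (e₀ * h₀) + x * (s * t * ((1# + y) * (e * h))) ∎
    where
    x = pow (suc n)
    y = pow (suc i)
    s = sgn (suc i)
    t = τ (suc i)
    b = β i
    e = E (suc n) (suc i)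
    e₀ = E n (suc i)
    h = H (suc n ℕ.+ suc i)
    h₀ = H (n ℕ.+ suc i)
    H-shift : h₀ ≈ (1# - x * y) * h
    H-shift = trans (reflexive (≡.cong H (ℕ.+-suc n i))) (H-step-+ (suc n) i)

  -- With x = q^m and y = q^(i+1), (1 - x)(1 + y) = (1 - xy) + (y - x). The first part lowers the
  -- index of `H`, the second raises that of `E` at the cost of a factor y, which `τ` absorbs. The
  -- sign change in `sgn` makes the second piece -`g m (suc i)`.
  d-telescopes : ∀ m i → (1# - pow m) * d m i ≈ g m i - g m (suc i)
  d-telescopes m i = begin
    (1# - x) * (s * t * ((1# + y) * (e * h)))
      ≈⟨ solve 6 (λ x y s t e h →
           (:1 :- x) :* (s :* t :* ((:1 :+ y) :* (e :* h)))
           := s :* t :* (e :* ((:1 :- x :* y) :* h)) :+ s :* t :* h :* ((y :- x) :* e))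
           refl x y s t e h ⟩
    s * t * (e * ((1# - x * y) * h)) + s * t * h * ((y - x) * e)
      ≈⟨ +-cong (*-congˡ (*-congˡ (H-step-+ m i))) (*-congˡ (E-step m (suc i))) ⟨
    g m i + s * t * h * (y * e₁)
      ≈⟨ +-congˡ (solve 5 (λ y s t e h → s :* t :* h :* (y :* e) := :- (:- s :* (y :* t) :* (e :* h))) refl y s t e₁ h) ⟩
    g m i - g m (suc i) ∎
    where
    x = pow m
    y = pow (suc i)
    s = sgn (suc i)
    t = τ (suc i)
    e = E m (suc i)
    e₁ = E m (suc (suc i))
    h = H (m ℕ.+ suc i)

  -- After multiplication by 1 - q^m the sum telescopes to `g m 0`, since the far end contains the
  -- vanishing `E m (suc m)`. In `g m 0` the factor `H n` equals (1 - q^m) `H m`, so 1 - q^m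
  -- cancels.
  ∑d : ∀ n → ∑ (d (suc n)) (suc n) ≈ - (H (suc n) * H (suc n))
  ∑d n = cancel (α-inverse n) (begin
    (1# - x) * ∑ (d m) m                ≈⟨ ∑-*ˡ (1# - x) (d m) m ⟨
    ∑ (λ i → (1# - x) * d m i) m        ≈⟨ ∑-cong (d-telescopes m) m ⟩
    ∑ (λ i → g m i - g m (suc i)) m     ≈⟨ ∑-telescope (g m) m ⟩
    g m 0 - g m m                       ≈⟨ +-cong first (trans (-‿cong last) -0#≈0#) ⟩
    - (((1# - x) * H m) * H m) + 0#     ≈⟨ +-identityʳ _ ⟩
    - (((1# - x) * H m) * H m)          ≈⟨ solve 2 (λ x h → :- (((:1 :- x) :* h) :* h) := (:1 :- x) :* :- (h :* h)) refl x (H m) ⟩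
    (1# - x) * - (H m * H m)            ∎)
    where
    m = suc n
    x = pow m
    first : g m 0 ≈ - (((1# - x) * H m) * H m)
    first = begin
      - 1# * (pow 0 * 1#) * (H n * H (m ℕ.+ 0))   ≈⟨ *-cong (*-congˡ (*-congʳ pow-0)) (*-cong (sym (H-step n)) (reflexive (≡.cong H (ℕ.+-identityʳ m)))) ⟩
      - 1# * (1# * 1#) * ((1# - x) * H m * H m)   ≈⟨ solve 1 (λ a → :- :1 :* (:1 :* :1) :* a := :- a) refl ((1# - x) * H m * H m) ⟩
      - (((1# - x) * H m) * H m)                  ∎
    last : g m m ≈ 0#
    last = trans (*-congˡ (trans (*-congʳ (E-above m)) (zeroˡ _))) (zeroʳ _)

  -- Induction on `n`, after multiplying by (1 + x)² with x = q^(n+1). This turns `A (suc n)`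
  -- squared into `A n` squared, and by `u-step` and `∑d` it changes the sum of the summands by -x
  -- h².
  finite-identity : ∀ n → A n * A n ≈ H n * H n + 4# * ∑ (u n) n
  finite-identity zero    = sym (trans (+-congˡ (zeroʳ 4#)) (+-identityʳ (1# * 1#)))
  finite-identity (suc n) = cancel (β-inverse n) (cancel (β-inverse n) (begin
    p * (p * (b * A n * (b * A n)))
      ≈⟨ solve 3 (λ p b a → p :* (p :* (b :* a :* (b :* a))) := (p :* b) :* (p :* b) :* (a :* a)) refl p b (A n) ⟩
    (p * b) * (p * b) * (A n * A n)
      ≈⟨ *-congʳ (*-cong (β-inverse n) (β-inverse n)) ⟩
    1# * 1# * (A n * A n)
      ≈⟨ trans (*-congʳ (*-identityˡ 1#)) (*-identityˡ _) ⟩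
    A n * A n
      ≈⟨ finite-identity n ⟩
    H n * H n + 4# * ∑ (u n) n
      ≈⟨ +-congʳ (*-cong (H-step n) (H-step n)) ⟨
    (1# - x) * h * ((1# - x) * h) + 4# * ∑ (u n) n
      -- Since (1 - x)² = (1 + x)² - 4x, the deficit 4x h² is exactly four times the change in the
      -- sum. This is where the coefficient 4 comes from.
      ≈⟨ solve 3 (λ x h U → (:1 :- x) :* h :* ((:1 :- x) :* h) :+ :4 :* U
           := (:1 :+ x) :* (:1 :+ x) :* (h :* h) :+ :4 :* (U :+ x :* :- (h :* h))) refl x h (∑ (u n) n) ⟩
    p * p * (h * h) + 4# * (∑ (u n) n + x * - (h * h))
      ≈⟨ +-congˡ (*-congˡ ∑u) ⟨
    p * p * (h * h) + 4# * (p * p * ∑ (u (suc n)) (suc n))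
      ≈⟨ solve 3 (λ p k U → p :* p :* k :+ :4 :* (p :* p :* U) := p :* (p :* (k :+ :4 :* U))) refl p (h * h) (∑ (u (suc n)) (suc n)) ⟩
    p * (p * (h * h + 4# * ∑ (u (suc n)) (suc n))) ∎))
    where
    x = pow (suc n)
    p = 1# + x
    b = β n
    h = H (suc n)
    ∑u : p * p * ∑ (u (suc n)) (suc n) ≈ ∑ (u n) n + x * - (h * h)
    ∑u = begin
      p * p * ∑ (u (suc n)) (suc n)                       ≈⟨ ∑-*ˡ (p * p) (u (suc n)) (suc n) ⟨
      ∑ (λ i → p * p * u (suc n) i) (suc n)               ≈⟨ ∑-cong (u-step n) (suc n) ⟩
      ∑ (λ i → u n i + x * d (suc n) i) (suc n)           ≈⟨ ∑-+ (u n) (λ i → x * d (suc n) i) (suc n) ⟩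
      ∑ (u n) (suc n) + ∑ (λ i → x * d (suc n) i) (suc n) ≈⟨ +-cong (+-congˡ u-last) (∑-*ˡ x (d (suc n)) (suc n)) ⟩
      ∑ (u n) n + 0# + x * ∑ (d (suc n)) (suc n)          ≈⟨ +-cong (+-identityʳ _) (*-congˡ (∑d n)) ⟩
      ∑ (u n) n + x * - (h * h)                           ∎
      where
      -- The sum for `n` has been extended by one term, with j = n + 1, where `E` is 0.
      u-last : u n n ≈ 0#
      u-last = trans (*-congˡ (trans (*-congʳ (E-above n)) (zeroˡ _))) (zeroʳ _)

  -- The products (q;q)_n and (-q;q)_n, inverse to `H n` and `A n`.
  Q V : ℕ → Carrier
  Q zero    = 1#
  Q (suc n) = (1# - pow (suc n)) * Q n
  V zero    = 1#
  V (suc n) = (1# + pow (suc n)) * V n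

  Q-inverse : ∀ n → Q n * H n ≈ 1#
  Q-inverse zero    = *-identityˡ 1#
  Q-inverse (suc n) = begin
    (1# - pow (suc n)) * Q n * (α n * H n)   ≈⟨ solve 4 (λ p a q h → p :* q :* (a :* h) := (p :* a) :* (q :* h)) refl _ (α n) (Q n) (H n) ⟩
    (1# - pow (suc n)) * α n * (Q n * H n)   ≈⟨ *-cong (α-inverse n) (Q-inverse n) ⟩
    1# * 1#                                  ≈⟨ *-identityˡ 1# ⟩
    1#                                       ∎

  V-inverse : ∀ n → V n * A n ≈ 1#
  V-inverse zero    = *-identityˡ 1#
  V-inverse (suc n) = begin
    (1# + pow (suc n)) * V n * (β n * A n)   ≈⟨ solve 4 (λ p a q h → p :* q :* (a :* h) := (p :* a) :* (q :* h)) refl _ (β n) (V n) (A n) ⟩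
    (1# + pow (suc n)) * β n * (V n * A n)   ≈⟨ *-cong (β-inverse n) (V-inverse n) ⟩
    1# * 1#                                  ≈⟨ *-identityˡ 1# ⟩
    1#                                       ∎

  -- The limit form of the identity modulo q^(n+1).

  module Truncated (n : ℕ) (pow-vanishes : pow (suc n) ≈ 0#) where

    -- The two values differ by factors 1 - q^k with k > n, all of which are 1 here.
    H-constant : ∀ j → H (n ℕ.+ j) ≈ H n
    H-constant zero    = reflexive (≡.cong H (ℕ.+-identityʳ n))
    H-constant (suc j) = begin
      H (n ℕ.+ suc j)                                 ≈⟨ *-identityˡ _ ⟨
      1# * H (n ℕ.+ suc j)                            ≈⟨ *-congʳ (trans (+-congˡ (trans (-‿cong vanishes) -0#≈0#)) (+-identityʳ 1#)) ⟨
      (1# - pow n * pow (suc j)) * H (n ℕ.+ suc j)    ≈⟨ H-step-+ n j ⟨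
      H (n ℕ.+ j)                                     ≈⟨ H-constant j ⟩
      H n                                             ∎
      where
      vanishes : pow n * pow (suc j) ≈ 0#
      vanishes = begin
        pow n * pow (suc j)   ≈⟨ pow-+ n (suc j) ⟨
        pow (n ℕ.+ suc j)     ≡⟨ ≡.cong pow (ℕ.+-suc n j) ⟩
        pow (suc n ℕ.+ j)     ≈⟨ pow-+ (suc n) j ⟩
        pow (suc n) * pow j   ≈⟨ *-congʳ pow-vanishes ⟩
        0# * pow j            ≈⟨ zeroˡ _ ⟩
        0#                    ∎

    -- For j ≤ n, 1/(q;q)_{n-j} and 1/(q;q)_n agree only through q^(n-j), hence the factor `pow j`.
    -- In the induction the correction from `E-step` carries q · q^n = 0.
    E-constant : ∀ j → pow j * E n j ≈ pow j * H n
    E-constant zero    = refl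
    E-constant (suc j) = begin
      pow (suc j) * E n (suc j)                       ≈⟨ trans (*-congʳ (pow-+ 1 j)) (*-assoc _ _ _) ⟩
      pow 1 * (pow j * E n (suc j))                   ≈⟨ *-congˡ (E-step n j) ⟩
      pow 1 * ((pow j - pow n) * E n j)               ≈⟨ solve 4 (λ q x y e → q :* ((x :- y) :* e) := q :* (x :* e) :- q :* y :* e) refl (pow 1) (pow j) (pow n) (E n j) ⟩
      pow 1 * (pow j * E n j) - pow 1 * pow n * E n j ≈⟨ +-cong (*-congˡ (E-constant j)) (-‿cong (*-congʳ (trans (sym (pow-+ 1 n)) pow-vanishes))) ⟩
      pow 1 * (pow j * H n) - 0# * E n j              ≈⟨ +-congˡ (trans (-‿cong (zeroˡ _)) -0#≈0#) ⟩
      pow 1 * (pow j * H n) + 0#                      ≈⟨ +-identityʳ _ ⟩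
      pow 1 * (pow j * H n)                           ≈⟨ trans (*-congʳ (pow-+ 1 j)) (*-assoc _ _ _) ⟨
      pow (suc j) * H n                               ∎

    u-constant : ∀ i → u n i ≈ H n * H n * w i
    u-constant i = begin
      s * (y * t * b) * (e * H (n ℕ.+ suc i))   ≈⟨ *-congˡ (*-congˡ (H-constant (suc i))) ⟩
      -- The factor y of `τ (suc (suc i))` is moved next to `e`, where `E-constant` needs it.
      s * (y * t * b) * (e * H n)               ≈⟨ solve 6 (λ y s t b e h → s :* (y :* t :* b) :* (e :* h) := s :* t :* b :* h :* (y :* e)) refl y s t b e (H n) ⟩
      s * t * b * H n * (y * e)                 ≈⟨ *-congˡ (E-constant (suc i)) ⟩
      s * t * b * H n * (y * H n)               ≈⟨ solve 5 (λ y s t b h → s :* t :* b :* h :* (y :* h) := h :* h :* (s :* (y :* t :* b))) refl y s t b (H n) ⟩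
      H n * H n * w i                           ∎
      where
      y = pow (suc i)
      s = sgn (suc i)
      t = τ (suc i)
      b = β i
      e = E n (suc i)

    -- Once the summands are truncated, every term of the finite identity carries `H n * H n`, and
    -- `Q n` cancels one of the two factors.
    crank-series : ∀ {r} → V n * V n * r ≈ 1# → Q n * r ≈ H n * (1# + 4# * ∑ w n)
    crank-series {r} r-inverse = begin
      -- Both `r` and `A n * A n` are inverse to `V n * V n`, so they coincide.
      Q n * r                                         ≈⟨ *-congˡ (cancel r-inverse (trans r-inverse (sym A²-inverse))) ⟩
      Q n * (A n * A n)                               ≈⟨ *-congˡ (finite-identity n) ⟩
      Q n * (H n * H n + 4# * ∑ (u n) n)              ≈⟨ *-congˡ (+-congˡ (*-congˡ (trans (∑-cong u-constant n) (∑-*ˡ (H n * H n) w n)))) ⟩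
      Q n * (H n * H n + 4# * (H n * H n * ∑ w n))    ≈⟨ solve 3 (λ q h W → q :* (h :* h :+ :4 :* (h :* h :* W)) := (q :* h) :* (h :* (:1 :+ :4 :* W))) refl (Q n) (H n) (∑ w n) ⟩
      Q n * H n * (H n * (1# + 4# * ∑ w n))           ≈⟨ *-congʳ (Q-inverse n) ⟩
      1# * (H n * (1# + 4# * ∑ w n))                  ≈⟨ *-identityˡ _ ⟩
      H n * (1# + 4# * ∑ w n)                         ∎
      where
      A²-inverse : V n * V n * (A n * A n) ≈ 1#
      A²-inverse = begin
        V n * V n * (A n * A n)     ≈⟨ solve 2 (λ v a → v :* v :* (a :* a) := (v :* a) :* (v :* a)) refl (V n) (A n) ⟩
        V n * A n * (V n * A n)     ≈⟨ *-cong (V-inverse n) (V-inverse n) ⟩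
        1# * 1#                     ≈⟨ *-identityˡ 1# ⟩
        1#                          ∎

  -- Solving the recurrences for the partition generating functions.

  geometric : ∀ {x y a} → y ≈ a + x * y → (1# - x) * y ≈ a
  geometric {x} {y} {a} eq = begin
    (1# - x) * y          ≈⟨ solve 2 (λ x y → (:1 :- x) :* y := y :- x :* y) refl x y ⟩
    y - x * y             ≈⟨ +-congʳ eq ⟩
    a + x * y - x * y     ≈⟨ solve 2 (λ a b → a :+ b :- b := a) refl a (x * y) ⟩
    a                     ∎

  -- Intended for partitions whose set of parts is 1, ..., m. Each part j occurs at least once and
  -- contributes q^j/(1 - q^j); the exponents add up to m(m+1)/2.
  full-run-series : (B : ℕ → Carrier) → B 0 ≈ 1# →
    (∀ m → (1# - pow (suc m)) * B (suc m) ≈ pow (suc m) * B m) → ∀ m → B m ≈ τ (suc m) * H m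
  full-run-series B B-0 B-step zero = begin
    B 0               ≈⟨ B-0 ⟩
    1#                ≈⟨ *-identityˡ 1# ⟨
    1# * 1#           ≈⟨ *-congʳ pow-0 ⟨
    pow 0 * 1#        ≈⟨ *-identityʳ _ ⟨
    pow 0 * 1# * 1#   ∎
  full-run-series B B-0 B-step (suc m) = cancel (α-inverse m) (begin
    (1# - x) * B (suc m)                      ≈⟨ B-step m ⟩
    x * B m                                   ≈⟨ *-congˡ (full-run-series B B-0 B-step m) ⟩
    x * (τ (suc m) * H m)                     ≈⟨ *-congˡ (*-congˡ (H-step m)) ⟨
    x * (τ (suc m) * ((1# - x) * H (suc m)))  ≈⟨ solve 3 (λ x t h → x :* (t :* ((:1 :- x) :* h)) := (:1 :- x) :* (x :* t :* h)) refl x (τ (suc m)) (H (suc m)) ⟩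
    (1# - x) * (x * τ (suc m) * H (suc m))    ∎)
    where x = pow (suc m)

  -- `B m` is meant to count the partitions with set of parts 1, ..., m, and `O m` to weigh by `ω`
  -- those with parts at most m. `X m` attaches to the latter any number of parts m + 1, `Z m` to
  -- the former an odd number. Each step adds one summand `w m` to the bracket.
  weight-series : (B O X Z : ℕ → Carrier) → (∀ m → B m ≈ τ (suc m) * H m) → O 0 ≈ 1# →
    (∀ m → O (suc m) ≈ X m + 4# * sgn (suc m) * Z m) →
    (∀ m → (1# - pow (suc m)) * X m ≈ O m) →
    (∀ m → (1# - pow (suc m) * pow (suc m)) * Z m ≈ pow (suc m) * B m) →
    ∀ m → O m ≈ H m * (1# + 4# * ∑ w m)
  weight-series B O X Z B-eq O-0 O-step X-eq Z-eq zero = trans O-0 (sym (trans (*-identityˡ _) (trans (+-congˡ (zeroʳ 4#)) (+-identityʳ 1#))))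
  weight-series B O X Z B-eq O-0 O-step X-eq Z-eq (suc m) = cancel (α-inverse m) (begin
    (1# - x) * O (suc m)
      ≈⟨ *-congˡ (O-step m) ⟩
    (1# - x) * (X m + 4# * s * Z m)
      ≈⟨ solve 4 (λ x X Z s → (:1 :- x) :* (X :+ :4 :* s :* Z) := (:1 :- x) :* X :+ :4 :* s :* ((:1 :- x) :* Z)) refl x (X m) (Z m) s ⟩
    (1# - x) * X m + 4# * s * ((1# - x) * Z m)
      ≈⟨ +-cong (trans (X-eq m) (weight-series B O X Z B-eq O-0 O-step X-eq Z-eq m)) (*-congˡ Z-value) ⟩
    H m * (1# + 4# * ∑ w m) + 4# * s * (x * t * β m * H m)
      ≈⟨ solve 6 (λ h W s x t b → h :* (:1 :+ :4 :* W) :+ :4 :* s :* (x :* t :* b :* h) := h :* (:1 :+ :4 :* (W :+ s :* (x :* t :* b)))) refl (H m) (∑ w m) s x t (β m) ⟩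
    H m * (1# + 4# * ∑ w (suc m))
      ≈⟨ *-congʳ (H-step m) ⟨
    (1# - x) * H (suc m) * (1# + 4# * ∑ w (suc m))
      ≈⟨ *-assoc _ _ _ ⟩
    (1# - x) * (H (suc m) * (1# + 4# * ∑ w (suc m))) ∎)
    where
    x = pow (suc m)
    s = sgn (suc m)
    t = τ (suc m)
    -- An odd number of copies gives x/(1 - x²). Of 1 - x² = (1 + x)(1 - x), the factor 1 - x is on
    -- the left already, and 1 + x becomes the denominator in `w m`.
    Z-value : (1# - x) * Z m ≈ x * t * β m * H m
    Z-value = cancel (β-inverse m) (begin
      (1# + x) * ((1# - x) * Z m)           ≈⟨ solve 2 (λ x z → (:1 :+ x) :* ((:1 :- x) :* z) := (:1 :- x :* x) :* z) refl x (Z m) ⟩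
      (1# - x * x) * Z m                    ≈⟨ Z-eq m ⟩
      x * B m                               ≈⟨ *-congˡ (B-eq m) ⟩
      x * (t * H m)                         ≈⟨ *-identityʳ _ ⟨
      x * (t * H m) * 1#                    ≈⟨ *-congˡ (β-inverse m) ⟨
      x * (t * H m) * ((1# + x) * β m)      ≈⟨ solve 4 (λ x t h b → x :* (t :* h) :* ((:1 :+ x) :* b) := (:1 :+ x) :* (x :* t :* b :* h)) refl x t (H m) (β m) ⟩
      (1# + x) * (x * t * β m * H m)        ∎)

-- Integer sums over lists.

module FiniteSums where

  open ≡ using (refl; sym; trans; cong; cong₂)
  open ≡.≡-Reasoning

  sumℤ-++ : ∀ xs ys → sumℤ (xs ++ ys) ≡ sumℤ xs ℤ.+ sumℤ ys
  sumℤ-++ []       ys = sym (ℤ.+-identityˡ _)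
  sumℤ-++ (x ∷ xs) ys = trans (cong (λ z → x ℤ.+ z) (sumℤ-++ xs ys)) (sym (ℤ.+-assoc x _ _))

  sumℤ-+ : ∀ {A : Set} (f g : A → ℤ) xs → sumℤ (map (λ x → f x ℤ.+ g x) xs) ≡ sumℤ (map f xs) ℤ.+ sumℤ (map g xs)
  sumℤ-+ f g []       = refl
  sumℤ-+ f g (x ∷ xs) = trans (cong (λ z → f x ℤ.+ g x ℤ.+ z) (sumℤ-+ f g xs)) (interchange (f x) (g x) _ _)
    where
    interchange : ∀ a b c d → (a ℤ.+ b) ℤ.+ (c ℤ.+ d) ≡ (a ℤ.+ c) ℤ.+ (b ℤ.+ d)
    interchange = solve-∀

  sumℤ-* : ∀ {A : Set} a (f : A → ℤ) xs → sumℤ (map (λ x → a ℤ.* f x) xs) ≡ a ℤ.* sumℤ (map f xs)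
  sumℤ-* a f []       = sym (ℤ.*-zeroʳ a)
  sumℤ-* a f (x ∷ xs) = trans (cong (λ z → a ℤ.* f x ℤ.+ z) (sumℤ-* a f xs)) (sym (ℤ.*-distribˡ-+ a (f x) _))

  sumℤ-concatMap : ∀ {A B : Set} (f : B → ℤ) (g : A → List B) xs →
    sumℤ (map f (concatMap g xs)) ≡ sumℤ (map (λ x → sumℤ (map f (g x))) xs)
  sumℤ-concatMap f g []       = refl
  sumℤ-concatMap f g (x ∷ xs) = begin
    sumℤ (map f (g x ++ concatMap g xs))                         ≡⟨ cong sumℤ (map-++ f (g x) _) ⟩
    sumℤ (map f (g x) ++ map f (concatMap g xs))                 ≡⟨ sumℤ-++ (map f (g x)) _ ⟩
    sumℤ (map f (g x)) ℤ.+ sumℤ (map f (concatMap g xs))         ≡⟨ cong (λ z → sumℤ (map f (g x)) ℤ.+ z) (sumℤ-concatMap f g xs) ⟩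
    sumℤ (map f (g x)) ℤ.+ sumℤ (map (λ y → sumℤ (map f (g y))) xs) ∎

open FiniteSums

-- Formal power series and their truncations.

module PowerSeries where

  open ≡ using (refl; sym; trans; cong; cong₂)
  open ≡.≡-Reasoning

  infixl 6 _⊕_

  _⊕_ : Series → Series → Series
  (f ⊕ g) n = f n ℤ.+ g n

  𝟘 : Series
  𝟘 n = 0ℤ

  constant : ℤ → Series
  constant a zero    = a
  constant a (suc n) = 0ℤ

  -- From f = f₀ + q · (`f ∘ suc`). This drives the inductions on the coefficient index below.
  ⊛-suc : ∀ f g n → (f ⊛ g) (suc n) ≡ f 0 ℤ.* g (suc n) ℤ.+ ((f ∘ suc) ⊛ g) n
  ⊛-suc f g n = cong sumℤ (map-upTo-suc (λ k → f k ℤ.* g (suc n ∸ k)) (suc n))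

  -- Mirror image of `⊛-suc`; commutativity follows by playing the two against each other.
  ⊛-sucʳ : ∀ f g n → (f ⊛ g) (suc n) ≡ (f ⊛ (g ∘ suc)) n ℤ.+ f (suc n) ℤ.* g 0
  ⊛-sucʳ f g zero    = rearrange (f 0 ℤ.* g 1) (f 1 ℤ.* g 0)
    where
    rearrange : ∀ a b → a ℤ.+ (b ℤ.+ 0ℤ) ≡ a ℤ.+ 0ℤ ℤ.+ b
    rearrange = solve-∀
  ⊛-sucʳ f g (suc n) = begin
    (f ⊛ g) (suc (suc n))                                                                    ≡⟨ ⊛-suc f g (suc n) ⟩
    f 0 ℤ.* g (suc (suc n)) ℤ.+ ((f ∘ suc) ⊛ g) (suc n)                                      ≡⟨ cong (λ z → f 0 ℤ.* g (suc (suc n)) ℤ.+ z) (⊛-sucʳ (f ∘ suc) g n) ⟩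
    f 0 ℤ.* g (suc (suc n)) ℤ.+ (((f ∘ suc) ⊛ (g ∘ suc)) n ℤ.+ f (suc (suc n)) ℤ.* g 0)      ≡⟨ ℤ.+-assoc (f 0 ℤ.* g (suc (suc n))) _ _ ⟨
    f 0 ℤ.* g (suc (suc n)) ℤ.+ ((f ∘ suc) ⊛ (g ∘ suc)) n ℤ.+ f (suc (suc n)) ℤ.* g 0        ≡⟨ cong (ℤ._+ f (suc (suc n)) ℤ.* g 0) (⊛-suc f (g ∘ suc) n) ⟨
    (f ⊛ (g ∘ suc)) (suc n) ℤ.+ f (suc (suc n)) ℤ.* g 0                                      ∎

  -- Coefficient `n` of a product sees only coefficients up to `n`, which makes truncated equality a
  -- congruence for `⊛`.
  ⊛-cong-below : ∀ {f f′ g g′} n → (∀ k → k ≤ n → f k ≡ f′ k) → (∀ k → k ≤ n → g k ≡ g′ k) → (f ⊛ g) n ≡ (f′ ⊛ g′) n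
  ⊛-cong-below {f} {f′} {g} {g′} n f≡ g≡ = cong sumℤ (map-cong-local {xs = upTo (suc n)} (All.tabulate (λ {k} k∈ →
    cong₂ ℤ._*_ (f≡ k (ℕ.s≤s⁻¹ (∈-upTo⁻ k∈))) (g≡ (n ∸ k) (ℕ.m∸n≤m n k)))))

  ⊛-congˡ : ∀ f {g g′} → g ≐ g′ → f ⊛ g ≐ f ⊛ g′
  ⊛-congˡ f g≐ n = ⊛-cong-below {f} {f} n (λ _ _ → refl) (λ k _ → g≐ k)

  ⊛-congʳ : ∀ {f f′} g → f ≐ f′ → f ⊛ g ≐ f′ ⊛ g
  ⊛-congʳ g f≐ n = ⊛-cong-below {g = g} {g} n (λ k _ → f≐ k) (λ _ _ → refl)

  ⊛-comm : ∀ f g → f ⊛ g ≐ g ⊛ f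
  ⊛-comm f g zero    = cong (ℤ._+ 0ℤ) (ℤ.*-comm (f 0) (g 0))
  ⊛-comm f g (suc n) = begin
    (f ⊛ g) (suc n)                                 ≡⟨ ⊛-suc f g n ⟩
    f 0 ℤ.* g (suc n) ℤ.+ ((f ∘ suc) ⊛ g) n         ≡⟨ cong₂ ℤ._+_ (ℤ.*-comm (f 0) (g (suc n))) (⊛-comm (f ∘ suc) g n) ⟩
    g (suc n) ℤ.* f 0 ℤ.+ (g ⊛ (f ∘ suc)) n         ≡⟨ ℤ.+-comm (g (suc n) ℤ.* f 0) _ ⟩
    (g ⊛ (f ∘ suc)) n ℤ.+ g (suc n) ℤ.* f 0         ≡⟨ ⊛-sucʳ g f n ⟨
    (g ⊛ f) (suc n)                                 ∎

  ⊛-distribˡ : ∀ f g h → f ⊛ (g ⊕ h) ≐ f ⊛ g ⊕ f ⊛ h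
  ⊛-distribˡ f g h n = trans
    (cong sumℤ (map-cong (λ k → ℤ.*-distribˡ-+ (f k) (g (n ∸ k)) (h (n ∸ k))) (upTo (suc n))))
    (sumℤ-+ (λ k → f k ℤ.* g (n ∸ k)) (λ k → f k ℤ.* h (n ∸ k)) (upTo (suc n)))

  ⊛-distribʳ : ∀ f g h → (g ⊕ h) ⊛ f ≐ g ⊛ f ⊕ h ⊛ f
  ⊛-distribʳ f g h n = trans (⊛-comm (g ⊕ h) f n) (trans (⊛-distribˡ f g h n) (cong₂ ℤ._+_ (⊛-comm f g n) (⊛-comm f h n)))

  ⊛-zeroˡ : ∀ f → 𝟘 ⊛ f ≐ 𝟘
  ⊛-zeroˡ f n = sumℤ-zero (λ k → 0ℤ ℤ.* f (n ∸ k)) (All.universal (λ _ → refl) (upTo (suc n)))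

  ⊛-scaleˡ : ∀ a f g n → ((λ k → a ℤ.* f k) ⊛ g) n ≡ a ℤ.* (f ⊛ g) n
  ⊛-scaleˡ a f g n = trans (cong sumℤ (map-cong (λ k → ℤ.*-assoc a (f k) (g (n ∸ k))) (upTo (suc n)))) (sumℤ-* a (λ k → f k ℤ.* g (n ∸ k)) (upTo (suc n)))

  -- The shift of `f ⊛ g` is f₀ times the shift of `g` plus `(f ∘ suc) ⊛ g`, so the induction
  -- hypothesis applies to `f ∘ suc`.
  ⊛-assoc : ∀ f g h → (f ⊛ g) ⊛ h ≐ f ⊛ (g ⊛ h)
  ⊛-assoc f g h zero    = assoc₀ (f 0) (g 0) (h 0)
    where
    assoc₀ : ∀ a b c → (a ℤ.* b ℤ.+ 0ℤ) ℤ.* c ℤ.+ 0ℤ ≡ a ℤ.* (b ℤ.* c ℤ.+ 0ℤ) ℤ.+ 0ℤ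
    assoc₀ = solve-∀
  ⊛-assoc f g h (suc n) = begin
    ((f ⊛ g) ⊛ h) (suc n)
      ≡⟨ ⊛-suc (f ⊛ g) h n ⟩
    (f ⊛ g) 0 ℤ.* h (suc n) ℤ.+ (((f ⊛ g) ∘ suc) ⊛ h) n
      ≡⟨ cong (λ z → (f ⊛ g) 0 ℤ.* h (suc n) ℤ.+ z) (⊛-congʳ h (⊛-suc f g) n) ⟩
    (f ⊛ g) 0 ℤ.* h (suc n) ℤ.+ (((λ k → f 0 ℤ.* g (suc k)) ⊕ (f ∘ suc) ⊛ g) ⊛ h) n
      ≡⟨ cong (λ z → (f ⊛ g) 0 ℤ.* h (suc n) ℤ.+ z) (⊛-distribʳ h (λ k → f 0 ℤ.* g (suc k)) ((f ∘ suc) ⊛ g) n) ⟩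
    (f ⊛ g) 0 ℤ.* h (suc n) ℤ.+ (((λ k → f 0 ℤ.* g (suc k)) ⊛ h) n ℤ.+ (((f ∘ suc) ⊛ g) ⊛ h) n)
      ≡⟨ cong (λ z → (f ⊛ g) 0 ℤ.* h (suc n) ℤ.+ z) (cong₂ ℤ._+_ (⊛-scaleˡ (f 0) (g ∘ suc) h n) (⊛-assoc (f ∘ suc) g h n)) ⟩
    (f ⊛ g) 0 ℤ.* h (suc n) ℤ.+ (f 0 ℤ.* ((g ∘ suc) ⊛ h) n ℤ.+ ((f ∘ suc) ⊛ (g ⊛ h)) n)
      ≡⟨ rearrange (f 0) (g 0) (h (suc n)) _ _ ⟩
    f 0 ℤ.* (g 0 ℤ.* h (suc n) ℤ.+ ((g ∘ suc) ⊛ h) n) ℤ.+ ((f ∘ suc) ⊛ (g ⊛ h)) n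
      ≡⟨ cong (λ x → f 0 ℤ.* x ℤ.+ ((f ∘ suc) ⊛ (g ⊛ h)) n) (⊛-suc g h n) ⟨
    f 0 ℤ.* (g ⊛ h) (suc n) ℤ.+ ((f ∘ suc) ⊛ (g ⊛ h)) n
      ≡⟨ ⊛-suc f (g ⊛ h) n ⟨
    (f ⊛ (g ⊛ h)) (suc n) ∎
    where
    rearrange : ∀ a b c d e → (a ℤ.* b ℤ.+ 0ℤ) ℤ.* c ℤ.+ (a ℤ.* d ℤ.+ e) ≡ a ℤ.* (b ℤ.* c ℤ.+ d) ℤ.+ e
    rearrange = solve-∀

  constant-⊛ : ∀ a f n → (constant a ⊛ f) n ≡ a ℤ.* f n
  constant-⊛ a f zero    = ℤ.+-identityʳ _
  constant-⊛ a f (suc n) = trans (⊛-suc (constant a) f n) (trans (cong (λ z → a ℤ.* f (suc n) ℤ.+ z) (⊛-zeroˡ f n)) (ℤ.+-identityʳ _))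

  constant-1 : constant 1ℤ ≐ 𝟙
  constant-1 zero    = refl
  constant-1 (suc n) = refl

  constant-+ : ∀ a b → constant (a ℤ.+ b) ≐ constant a ⊕ constant b
  constant-+ a b zero    = refl
  constant-+ a b (suc n) = refl

  constant-* : ∀ a b → constant (a ℤ.* b) ≐ constant a ⊛ constant b
  constant-* a b zero    = sym (constant-⊛ a (constant b) 0)
  constant-* a b (suc n) = sym (trans (constant-⊛ a (constant b) (suc n)) (ℤ.*-zeroʳ a))

  constant-neg : ∀ a → constant (ℤ.- a) ≐ neg (constant a)
  constant-neg a zero    = refl
  constant-neg a (suc n) = refl

  ⊛-identityˡ : ∀ f → 𝟙 ⊛ f ≐ f
  ⊛-identityˡ f n = trans (⊛-congʳ f (sym ∘ constant-1) n) (trans (constant-⊛ 1ℤ f n) (ℤ.*-identityˡ (f n)))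

  q^-⊛-below : ∀ j f n → n < j → (q^ j ⊛ f) n ≡ 0ℤ
  q^-⊛-below (suc j) f zero    _       = refl
  q^-⊛-below (suc j) f (suc n) (s≤s p) = trans (⊛-suc (q^ (suc j)) f n) (trans (ℤ.+-identityˡ _) (q^-⊛-below j f n p))

  q^-⊛-above : ∀ j f n → j ≤ n → (q^ j ⊛ f) n ≡ f (n ∸ j)
  q^-⊛-above zero    f n       _       = ⊛-identityˡ f n
  q^-⊛-above (suc j) f (suc n) (s≤s p) = trans (⊛-suc (q^ (suc j)) f n) (trans (ℤ.+-identityˡ _) (q^-⊛-above j f n p))

  q^-+ : ∀ m n → q^ (m ℕ.+ n) ≐ q^ m ⊛ q^ n
  q^-+ zero    n k       = sym (⊛-identityˡ (q^ n) k)
  q^-+ (suc m) n zero    = refl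
  q^-+ (suc m) n (suc k) = trans (q^-+ m n k) (sym (trans (⊛-suc (q^ (suc m)) (q^ n) k) (ℤ.+-identityˡ _)))

  -- The quotient ℤ[[q]]/(q^K) as a setoid: series are kept whole and only the equality is
  -- coarsened.
  module Modulo (K : ℕ) where

    infix 4 _≈_

    _≈_ : Series → Series → Set
    f ≈ g = ∀ n → n < K → f n ≡ g n

    exact : ∀ {f g} → f ≐ g → f ≈ g
    exact f≐g n _ = f≐g n

    ⊛-cong : ∀ {f f′ g g′} → f ≈ f′ → g ≈ g′ → f ⊛ g ≈ f′ ⊛ g′
    ⊛-cong f≈ g≈ n n<K = ⊛-cong-below n (λ k k≤n → f≈ k (ℕ.≤-<-trans k≤n n<K)) (λ k k≤n → g≈ k (ℕ.≤-<-trans k≤n n<K))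

    ring : CommutativeRing 0ℓ 0ℓ
    ring = record
      { Carrier = Series
      ; _≈_ = _≈_
      ; _+_ = _⊕_
      ; _*_ = _⊛_
      ; -_ = neg
      ; 0# = 𝟘
      ; 1# = 𝟙
      ; isCommutativeRing = record
        { isRing = record
          { +-isAbelianGroup = record
            { isGroup = record
              { isMonoid = record
                { isSemigroup = record
                  { isMagma = record
                    { isEquivalence = record
                      { refl = λ _ _ → refl
                      ; sym = λ f≈g n p → sym (f≈g n p)
                      ; trans = λ f≈g g≈h n p → trans (f≈g n p) (g≈h n p)
                      }
                    ; ∙-cong = λ f≈ g≈ n p → cong₂ ℤ._+_ (f≈ n p) (g≈ n p)
                    }
                  ; assoc = λ f g h n _ → ℤ.+-assoc (f n) (g n) (h n)
                  }
                ; identity = (λ f n _ → ℤ.+-identityˡ (f n)) , (λ f n _ → ℤ.+-identityʳ (f n))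
                }
              ; inverse = (λ f n _ → ℤ.+-inverseˡ (f n)) , (λ f n _ → ℤ.+-inverseʳ (f n))
              ; ⁻¹-cong = λ f≈ n p → cong ℤ.-_ (f≈ n p)
              }
            ; comm = λ f g n _ → ℤ.+-comm (f n) (g n)
            }
          ; *-cong = ⊛-cong
          ; *-assoc = λ f g h → exact (⊛-assoc f g h)
          ; *-identity = (λ f → exact (⊛-identityˡ f)) , (λ f n _ → trans (⊛-comm f 𝟙 n) (⊛-identityˡ f n))
          ; distrib = (λ f g h → exact (⊛-distribˡ f g h)) , (λ f g h → exact (⊛-distribʳ f g h))
          }
        ; *-comm = λ f g → exact (⊛-comm f g)
        }
      }

    ℤ⟶ring : CommutativeRing.rawRing ℤ.+-*-commutativeRing -Raw-AlmostCommutative⟶ fromCommutativeRing ring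
    ℤ⟶ring = record
      { ⟦_⟧ = constant
      ; +-homo = λ a b → exact (constant-+ a b)
      ; *-homo = λ a b → exact (constant-* a b)
      ; -‿homo = λ a → exact (constant-neg a)
      ; 0-homo = exact (λ { zero → refl ; (suc _) → refl })
      ; 1-homo = exact constant-1
      }

open PowerSeries

-- Generating functions of partitions with bounded parts.

module PartitionSeries where

  open ≡ using (refl; sym; trans; cong; cong₂)
  open ≡.≡-Reasoning

  gf : (List ℕ → ℤ) → ℕ → Series
  gf f m n = sumℤ (map f (partitions≤ m n))

  -- The product of `f` with Σ c_k x^k, where x = q^(d+1), written coefficientwise to match the
  -- enumeration by multiplicity in `partitions≤`.
  stride : (ℕ → ℤ) → ℕ → Series → Series
  stride c d f n = sumℤ (map (λ k → c k ℤ.* f (n ∸ k ℕ.* suc d)) (upTo (suc (n / suc d))))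

  -- Below degree d + 1 only k = 0 contributes. From there on, removing one copy lowers the quotient
  -- by one, and the terms with k ≥ 1 form the sum for the shifted `c` at n - (d + 1).
  stride-step : ∀ c d f n → stride c d f n ≡ c 0 ℤ.* f n ℤ.+ (q^ (suc d) ⊛ stride (c ∘ suc) d f) n
  stride-step c d f n with n ℕ.<? suc d
  ... | yes n<d = begin
    stride c d f n                                           ≡⟨ cong (λ k → sumℤ (map (λ k → c k ℤ.* f (n ∸ k ℕ.* suc d)) (upTo (suc k)))) (ℕ.m<n⇒m/n≡0 n<d) ⟩
    c 0 ℤ.* f n ℤ.+ 0ℤ                                       ≡⟨ cong (λ z → c 0 ℤ.* f n ℤ.+ z) (q^-⊛-below (suc d) (stride (c ∘ suc) d f) n n<d) ⟨
    c 0 ℤ.* f n ℤ.+ (q^ (suc d) ⊛ stride (c ∘ suc) d f) n    ∎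
  ... | no n≮d = begin
    sumℤ (map F (upTo (suc (n / suc d))))                    ≡⟨ cong (λ k → sumℤ (map F (upTo (suc k)))) (ℕ.m/n≡1+[m∸n]/n d≤n) ⟩
    sumℤ (map F (upTo (suc (suc r))))                        ≡⟨ cong sumℤ (map-upTo-suc F (suc r)) ⟩
    c 0 ℤ.* f n ℤ.+ sumℤ (map (F ∘ suc) (upTo (suc r)))      ≡⟨ cong (λ xs → c 0 ℤ.* f n ℤ.+ sumℤ xs) (map-cong (λ k → cong (λ i → c (suc k) ℤ.* f i) (ℕ.∸-+-assoc n (suc d) (k ℕ.* suc d))) (upTo (suc r))) ⟨
    c 0 ℤ.* f n ℤ.+ stride (c ∘ suc) d f (n ∸ suc d)         ≡⟨ cong (λ z → c 0 ℤ.* f n ℤ.+ z) (q^-⊛-above (suc d) (stride (c ∘ suc) d f) n d≤n) ⟨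
    c 0 ℤ.* f n ℤ.+ (q^ (suc d) ⊛ stride (c ∘ suc) d f) n    ∎
    where
    d≤n : suc d ≤ n
    d≤n = ℕ.≮⇒≥ n≮d
    r = (n ∸ suc d) / suc d
    F : ℕ → ℤ
    F k = c k ℤ.* f (n ∸ k ℕ.* suc d)

  -- Indicators of admissible multiplicities. By computation, `always` and `positive` shifted by one
  -- are `always`, and `odd` shifted by two is `odd`.
  always positive odd : ℕ → ℤ
  always _         = 1ℤ
  positive zero    = 0ℤ
  positive (suc k) = 1ℤ
  odd zero          = 0ℤ
  odd (suc zero)    = 1ℤ
  odd (suc (suc k)) = odd k

  stride-step₀ : ∀ {c} d f → c 0 ≡ 0ℤ → stride c d f ≐ q^ (suc d) ⊛ stride (c ∘ suc) d f
  stride-step₀ {c} d f c₀ n = begin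
    stride c d f n                        ≡⟨ stride-step c d f n ⟩
    c 0 ℤ.* f n ℤ.+ rest                  ≡⟨ cong (λ a → a ℤ.* f n ℤ.+ rest) c₀ ⟩
    0ℤ ℤ.+ rest                           ≡⟨ ℤ.+-identityˡ rest ⟩
    rest                                  ∎
    where rest = (q^ (suc d) ⊛ stride (c ∘ suc) d f) n

  stride-step₁ : ∀ {c} d f → c 0 ≡ 1ℤ → stride c d f ≐ f ⊕ q^ (suc d) ⊛ stride (c ∘ suc) d f
  stride-step₁ {c} d f c₀ n = begin
    stride c d f n                        ≡⟨ stride-step c d f n ⟩
    c 0 ℤ.* f n ℤ.+ rest                  ≡⟨ cong (λ a → a ℤ.* f n ℤ.+ rest) c₀ ⟩
    1ℤ ℤ.* f n ℤ.+ rest                   ≡⟨ cong (ℤ._+ rest) (ℤ.*-identityˡ (f n)) ⟩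
    f n ℤ.+ rest                          ∎
    where rest = (q^ (suc d) ⊛ stride (c ∘ suc) d f) n

  stride-odd : ∀ d f → stride odd d f ≐ q^ (suc d) ⊛ (f ⊕ q^ (suc d) ⊛ stride odd d f)
  stride-odd d f n = trans (stride-step₀ {odd} d f refl n) (⊛-congˡ (q^ (suc d)) (stride-step₁ {odd ∘ suc} d f refl) n)

  gf-suc : ∀ f m n → gf f (suc m) n ≡
    sumℤ (map (λ k → gf (λ ys → f (replicate k (suc m) ++ ys)) m (n ∸ k ℕ.* suc m)) (upTo (suc (n / suc m))))
  gf-suc f m n = trans
    (sumℤ-concatMap f (λ k → map (replicate k (suc m) ++_) (partitions≤ m (n ∸ k ℕ.* suc m))) (upTo (suc (n / suc m))))
    (cong sumℤ (map-cong (λ k → cong sumℤ (sym (map-∘ (partitions≤ m (n ∸ k ℕ.* suc m))))) (upTo (suc (n / suc m)))))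

  -- Soundness of the enumeration supplies the bound on the parts that the lemmas on `replicate`
  -- assume.
  gf-cong : ∀ {f g} m → (∀ {ys} → All (_≤ m) ys → f ys ≡ g ys) → gf f m ≐ gf g m
  gf-cong m f≡g n = cong sumℤ (map-cong-local (All.tabulate (λ ys∈ → f≡g (proj₂ (partitions≤-sound m n ys∈)))))

  gf-* : ∀ a f m n → gf (λ ys → a ℤ.* f ys) m n ≡ a ℤ.* gf f m n
  gf-* a f m n = sumℤ-* a f (partitions≤ m n)

  -- Effect of a new largest part on runs and weights.

  hasRun⁺ : ∀ {xs} r → (∀ {j} → j < r → suc j ∈ xs) → HasRun xs r
  hasRun⁺ r f = All.map⁺ (All.tabulate (λ j∈ → f (∈-upTo⁻ j∈)))

  hasRun⁻ : ∀ {xs r j} → HasRun xs r → j < r → suc j ∈ xs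
  hasRun⁻ h j<r = All.lookup h (∈-map⁺ suc (∈-upTo⁺ j<r))

  hasRun-≤ : ∀ {xs r s} → s ≤ r → HasRun xs r → HasRun xs s
  hasRun-≤ {s = s} s≤r h = hasRun⁺ s (λ j<s → hasRun⁻ h (ℕ.<-≤-trans j<s s≤r))

  ∈-replicate-++⁻ : ∀ {j a : ℕ} k {ys} → ¬ j ≡ a → j ∈ replicate k a ++ ys → j ∈ ys
  ∈-replicate-++⁻ zero    j≢a j∈         = j∈
  ∈-replicate-++⁻ (suc k) j≢a (here j≡a) = ⊥-elim (j≢a j≡a)
  ∈-replicate-++⁻ (suc k) j≢a (there j∈) = ∈-replicate-++⁻ k j≢a j∈

  hasRun-replicate⁻ : ∀ k {m s ys} → s ≤ m → HasRun (replicate k (suc m) ++ ys) s → HasRun ys s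
  hasRun-replicate⁻ k {s = s} s≤m h = hasRun⁺ s (λ j<s →
    ∈-replicate-++⁻ k (ℕ.<⇒≢ (s≤s (ℕ.<-≤-trans j<s s≤m))) (hasRun⁻ h j<s))

  hasRun-replicate⁺ : ∀ k {a s ys} → HasRun ys s → HasRun (replicate k a ++ ys) s
  hasRun-replicate⁺ k {a} = All.map (∈-++⁺ʳ (replicate k a))

  hasRun-extend : ∀ k {m ys} → HasRun ys m → HasRun (replicate (suc k) (suc m) ++ ys) (suc m)
  hasRun-extend k {m} {ys} h = hasRun⁺ (suc m) member
    where
    member : ∀ {j} → j < suc m → suc j ∈ replicate (suc k) (suc m) ++ ys
    member (s≤s j≤m) with ℕ.m≤n⇒m<n∨m≡n j≤m
    ... | inj₁ j<m  = ∈-++⁺ʳ (replicate (suc k) (suc m)) (hasRun⁻ h j<m)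
    ... | inj₂ refl = here refl

  hasRun-bounded : ∀ {m s ys} → All (_≤ m) ys → HasRun ys s → s ≤ m
  hasRun-bounded {s = zero}  ys≤m h = z≤n
  hasRun-bounded {s = suc s} ys≤m h = All.lookup ys≤m (hasRun⁻ h (ℕ.n<1+n s))

  runLength-unique : ∀ {xs r} → HasRun xs r → (∀ {s} → HasRun xs s → s ≤ r) → runLength xs ≡ r
  runLength-unique {xs} {r} h greatest = ℕ.≤-antisym (greatest (runLength-hasRun xs)) (runLength-greatest xs r h)

  multiplicity-other : ∀ {j a} k ys → ¬ a ≡ j → multiplicity j (replicate k a ++ ys) ≡ multiplicity j ys
  multiplicity-other zero    ys a≢j = refl
  multiplicity-other (suc k) ys a≢j = trans (cong length (filter-reject (ℕ._≟ _) a≢j)) (multiplicity-other k ys a≢j)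

  multiplicity-largest : ∀ {m} k {ys} → All (_≤ m) ys → multiplicity (suc m) (replicate k (suc m) ++ ys) ≡ k
  multiplicity-largest {m} zero ys≤m = cong length (filter-none (ℕ._≟ suc m) (All.map (λ y≤m → ℕ.<⇒≢ (s≤s y≤m)) ys≤m))
  multiplicity-largest {m} (suc k) ys≤m = trans (cong length (filter-accept (ℕ._≟ suc m) refl)) (cong suc (multiplicity-largest k ys≤m))

  -- The sum inside `ω` with the run length left free, so that induction on it is possible.
  oddSum : List ℕ → ℕ → ℤ
  oddSum xs r = sumℤ (map (-1ℤ ℤ.^_) (filter (occursOddly? xs) [1‥ r ]))

  odd-yes : ∀ k → k % 2 ≡ 1 → odd k ≡ 1ℤ
  odd-yes (suc zero)    _ = refl
  odd-yes (suc (suc k)) p = odd-yes k p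

  odd-no : ∀ k → ¬ k % 2 ≡ 1 → odd k ≡ 0ℤ
  odd-no zero          _ = refl
  odd-no (suc zero)    p = ⊥-elim (p refl)
  odd-no (suc (suc k)) p = odd-no k p

  oddSum-suc : ∀ xs r → oddSum xs (suc r) ≡ oddSum xs r ℤ.+ odd (multiplicity (suc r) xs) ℤ.* -1ℤ ℤ.^ suc r
  oddSum-suc xs r = begin
    oddSum xs (suc r)
      ≡⟨ cong (sumℤ ∘ map (-1ℤ ℤ.^_) ∘ filter P?) (trans (cong (map suc) (sym (upTo-∷ʳ r))) (map-++ suc (upTo r) [ r ])) ⟩
    sumℤ (map (-1ℤ ℤ.^_) (filter P? ([1‥ r ] ++ [ suc r ])))
      ≡⟨ cong (sumℤ ∘ map (-1ℤ ℤ.^_)) (filter-++ P? [1‥ r ] [ suc r ]) ⟩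
    sumℤ (map (-1ℤ ℤ.^_) (filter P? [1‥ r ] ++ filter P? [ suc r ]))
      ≡⟨ cong sumℤ (map-++ (-1ℤ ℤ.^_) (filter P? [1‥ r ]) _) ⟩
    sumℤ (map (-1ℤ ℤ.^_) (filter P? [1‥ r ]) ++ map (-1ℤ ℤ.^_) (filter P? [ suc r ]))
      ≡⟨ sumℤ-++ (map (-1ℤ ℤ.^_) (filter P? [1‥ r ])) _ ⟩
    oddSum xs r ℤ.+ sumℤ (map (-1ℤ ℤ.^_) (filter P? [ suc r ]))
      ≡⟨ cong (λ z → oddSum xs r ℤ.+ z) last ⟩
    oddSum xs r ℤ.+ odd (multiplicity (suc r) xs) ℤ.* -1ℤ ℤ.^ suc r ∎
    where
    P? = occursOddly? xs
    last : sumℤ (map (-1ℤ ℤ.^_) (filter P? [ suc r ])) ≡ odd (multiplicity (suc r) xs) ℤ.* -1ℤ ℤ.^ suc r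
    last with P? (suc r)
    ... | yes p = trans (cong (sumℤ ∘ map (-1ℤ ℤ.^_)) (filter-accept P? p)) (trans (ℤ.+-identityʳ _) (trans (sym (ℤ.*-identityˡ _)) (cong (ℤ._* -1ℤ ℤ.^ suc r) (sym (odd-yes (multiplicity (suc r) xs) p)))))
    ... | no ¬p = trans (cong (sumℤ ∘ map (-1ℤ ℤ.^_)) (filter-reject P? ¬p)) (cong (ℤ._* -1ℤ ℤ.^ suc r) (sym (odd-no (multiplicity (suc r) xs) ¬p)))

  -- Copies of m + 1 do not alter the multiplicity of any j ≤ m.
  oddSum-replicate : ∀ k {m} ys r → r ≤ m → oddSum (replicate k (suc m) ++ ys) r ≡ oddSum ys r
  oddSum-replicate k ys zero    _ = refl
  oddSum-replicate k {m} ys (suc r) r<m = begin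
    oddSum xs (suc r)                                                   ≡⟨ oddSum-suc xs r ⟩
    oddSum xs r ℤ.+ odd (multiplicity (suc r) xs) ℤ.* -1ℤ ℤ.^ suc r     ≡⟨ cong₂ (λ a k → a ℤ.+ odd k ℤ.* -1ℤ ℤ.^ suc r) (oddSum-replicate k ys r (ℕ.<⇒≤ r<m)) (multiplicity-other k ys (ℕ.>⇒≢ (s≤s r<m))) ⟩
    oddSum ys r ℤ.+ odd (multiplicity (suc r) ys) ℤ.* -1ℤ ℤ.^ suc r     ≡⟨ oddSum-suc ys r ⟨
    oddSum ys (suc r)                                                   ∎
    where xs = replicate k (suc m) ++ ys

  fullRun : ℕ → List ℕ → ℤ
  fullRun m ys = if does (hasRun? ys m) then 1ℤ else 0ℤ

  fullRun-yes : ∀ {m ys} → HasRun ys m → fullRun m ys ≡ 1ℤ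
  fullRun-yes {m} {ys} h = cong (if_then 1ℤ else 0ℤ) (dec-true (hasRun? ys m) h)

  fullRun-no : ∀ {m ys} → ¬ HasRun ys m → fullRun m ys ≡ 0ℤ
  fullRun-no {m} {ys} ¬h = cong (if_then 1ℤ else 0ℤ) (dec-false (hasRun? ys m) ¬h)

  fullRun-replicate : ∀ {m} k {ys} → All (_≤ m) ys → fullRun (suc m) (replicate k (suc m) ++ ys) ≡ positive k ℤ.* fullRun m ys
  fullRun-replicate zero ys≤m = fullRun-no (λ h → ℕ.1+n≰n (hasRun-bounded ys≤m h))
  fullRun-replicate {m} (suc k) {ys} ys≤m with hasRun? ys m
  ... | yes h = fullRun-yes (hasRun-extend k h)
  ... | no ¬h = fullRun-no (λ h → ¬h (hasRun-replicate⁻ (suc k) ℕ.≤-refl (hasRun-≤ (ℕ.n≤1+n m) h)))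

  signed4 : ℕ → ℤ
  signed4 j = + 4 ℤ.* -1ℤ ℤ.^ j

  -- If `ys` contains all of 1, ..., m, then copies of m + 1 lengthen the run by one, and the new
  -- term counts when `k` is odd. Otherwise the run of `ys` already stops below m, and nothing
  -- changes.
  ω-replicate : ∀ {m} k {ys} → All (_≤ m) ys →
    ω (replicate k (suc m) ++ ys) ≡ ω ys ℤ.+ odd k ℤ.* (signed4 (suc m) ℤ.* fullRun m ys)
  ω-replicate zero {ys} ys≤m = sym (ℤ.+-identityʳ (ω ys))
  ω-replicate {m} (suc k) {ys} ys≤m with hasRun? ys m
  ... | yes h = begin
    1ℤ ℤ.+ + 4 ℤ.* oddSum xs (runLength xs)
      -- The run is exactly m + 1 long, since no part exceeds m + 1.
      ≡⟨ cong (λ r → 1ℤ ℤ.+ + 4 ℤ.* oddSum xs r) (runLength-unique (hasRun-extend k h) (hasRun-bounded (all-replicate-++ (suc k) ℕ.≤-refl (All.map ℕ.m≤n⇒m≤1+n ys≤m)))) ⟩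
    1ℤ ℤ.+ + 4 ℤ.* oddSum xs (suc m)
      ≡⟨ cong (λ a → 1ℤ ℤ.+ + 4 ℤ.* a) (oddSum-suc xs m) ⟩
    1ℤ ℤ.+ + 4 ℤ.* (oddSum xs m ℤ.+ odd (multiplicity (suc m) xs) ℤ.* -1ℤ ℤ.^ suc m)
      ≡⟨ cong₂ (λ a j → 1ℤ ℤ.+ + 4 ℤ.* (a ℤ.+ odd j ℤ.* -1ℤ ℤ.^ suc m)) (oddSum-replicate (suc k) ys m ℕ.≤-refl) (multiplicity-largest (suc k) ys≤m) ⟩
    1ℤ ℤ.+ + 4 ℤ.* (oddSum ys m ℤ.+ odd (suc k) ℤ.* -1ℤ ℤ.^ suc m)
      ≡⟨ rearrange (oddSum ys m) (odd (suc k)) (-1ℤ ℤ.^ suc m) ⟩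
    1ℤ ℤ.+ + 4 ℤ.* oddSum ys m ℤ.+ odd (suc k) ℤ.* (signed4 (suc m) ℤ.* 1ℤ)
      ≡⟨ cong (λ r → 1ℤ ℤ.+ + 4 ℤ.* oddSum ys r ℤ.+ odd (suc k) ℤ.* (signed4 (suc m) ℤ.* 1ℤ)) (runLength-unique h (hasRun-bounded ys≤m)) ⟨
    ω ys ℤ.+ odd (suc k) ℤ.* (signed4 (suc m) ℤ.* 1ℤ) ∎
    where
    xs = replicate (suc k) (suc m) ++ ys
    rearrange : ∀ a o s → 1ℤ ℤ.+ + 4 ℤ.* (a ℤ.+ o ℤ.* s) ≡ 1ℤ ℤ.+ + 4 ℤ.* a ℤ.+ o ℤ.* (+ 4 ℤ.* s ℤ.* 1ℤ)
    rearrange = solve-∀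
  ... | no ¬h = begin
    1ℤ ℤ.+ + 4 ℤ.* oddSum xs (runLength xs)
      ≡⟨ cong (λ r → 1ℤ ℤ.+ + 4 ℤ.* oddSum xs r) (runLength-unique (hasRun-replicate⁺ (suc k) (runLength-hasRun ys)) greatest) ⟩
    1ℤ ℤ.+ + 4 ℤ.* oddSum xs (runLength ys)
      ≡⟨ cong (λ a → 1ℤ ℤ.+ + 4 ℤ.* a) (oddSum-replicate (suc k) ys (runLength ys) (hasRun-bounded ys≤m (runLength-hasRun ys))) ⟩
    ω ys
      ≡⟨ annihilate (ω ys) (odd (suc k)) (signed4 (suc m)) ⟩
    ω ys ℤ.+ odd (suc k) ℤ.* (signed4 (suc m) ℤ.* 0ℤ) ∎
    where
    xs = replicate (suc k) (suc m) ++ ys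
    annihilate : ∀ a o s → a ≡ a ℤ.+ o ℤ.* (s ℤ.* 0ℤ)
    annihilate = solve-∀
    -- A run longer than m would take 1, ..., m entirely from `ys`, against `¬h`.
    greatest : ∀ {s} → HasRun xs s → s ≤ runLength ys
    greatest {s} h with ℕ.≤-<-connex s m
    ... | inj₁ s≤m = runLength-greatest ys s (hasRun-replicate⁻ (suc k) s≤m h)
    ... | inj₂ m<s = ⊥-elim (¬h (hasRun-replicate⁻ (suc k) ℕ.≤-refl (hasRun-≤ (ℕ.<⇒≤ m<s) h)))

  -- Recurrences in the bound on the parts.

  gf-fullRun-suc : ∀ m → gf (fullRun (suc m)) (suc m) ≐ stride positive m (gf (fullRun m) m)
  gf-fullRun-suc m n = trans (gf-suc (fullRun (suc m)) m n) (cong sumℤ (map-cong (λ k →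
    trans (gf-cong m (fullRun-replicate k) _) (gf-* (positive k) (fullRun m) m _)) (upTo (suc (n / suc m)))))

  -- `ω-replicate` summed over the multiplicity `k` of m + 1: its first term occurs for every `k`,
  -- its second for odd `k` only.
  gf-ω-suc : ∀ m → gf ω (suc m) ≐ stride always m (gf ω m) ⊕ constant (signed4 (suc m)) ⊛ stride odd m (gf (fullRun m) m)
  gf-ω-suc m n = begin
    gf ω (suc m) n
      ≡⟨ gf-suc ω m n ⟩
    sumℤ (map (λ k → gf (λ ys → ω (replicate k (suc m) ++ ys)) m (n′ k)) ks)
      ≡⟨ cong sumℤ (map-cong block ks) ⟩
    sumℤ (map (λ k → 1ℤ ℤ.* gf ω m (n′ k) ℤ.+ a ℤ.* (odd k ℤ.* gf (fullRun m) m (n′ k))) ks)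
      ≡⟨ sumℤ-+ (λ k → 1ℤ ℤ.* gf ω m (n′ k)) (λ k → a ℤ.* (odd k ℤ.* gf (fullRun m) m (n′ k))) ks ⟩
    stride always m (gf ω m) n ℤ.+ sumℤ (map (λ k → a ℤ.* (odd k ℤ.* gf (fullRun m) m (n′ k))) ks)
      ≡⟨ cong (λ z → stride always m (gf ω m) n ℤ.+ z) (trans (sumℤ-* a (λ k → odd k ℤ.* gf (fullRun m) m (n′ k)) ks) (sym (constant-⊛ a (stride odd m (gf (fullRun m) m)) n))) ⟩
    stride always m (gf ω m) n ℤ.+ (constant a ⊛ stride odd m (gf (fullRun m) m)) n ∎
    where
    a = signed4 (suc m)
    ks = upTo (suc (n / suc m))
    n′ : ℕ → ℕ
    n′ k = n ∸ k ℕ.* suc m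
    swap : ∀ o a x → o ℤ.* (a ℤ.* x) ≡ a ℤ.* (o ℤ.* x)
    swap = solve-∀
    block : ∀ k → gf (λ ys → ω (replicate k (suc m) ++ ys)) m (n′ k) ≡ 1ℤ ℤ.* gf ω m (n′ k) ℤ.+ a ℤ.* (odd k ℤ.* gf (fullRun m) m (n′ k))
    block k = begin
      gf (λ ys → ω (replicate k (suc m) ++ ys)) m (n′ k)                             ≡⟨ gf-cong m (ω-replicate k) (n′ k) ⟩
      gf (λ ys → ω ys ℤ.+ odd k ℤ.* (a ℤ.* fullRun m ys)) m (n′ k)                   ≡⟨ sumℤ-+ ω (λ ys → odd k ℤ.* (a ℤ.* fullRun m ys)) (partitions≤ m (n′ k)) ⟩
      gf ω m (n′ k) ℤ.+ gf (λ ys → odd k ℤ.* (a ℤ.* fullRun m ys)) m (n′ k)          ≡⟨ cong (λ z → gf ω m (n′ k) ℤ.+ z) (trans (gf-* (odd k) (λ ys → a ℤ.* fullRun m ys) m (n′ k)) (cong (odd k ℤ.*_) (gf-* a (fullRun m) m (n′ k)))) ⟩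
      gf ω m (n′ k) ℤ.+ odd k ℤ.* (a ℤ.* gf (fullRun m) m (n′ k))                    ≡⟨ cong₂ ℤ._+_ (sym (ℤ.*-identityˡ (gf ω m (n′ k)))) (swap (odd k) a (gf (fullRun m) m (n′ k))) ⟩
      1ℤ ℤ.* gf ω m (n′ k) ℤ.+ a ℤ.* (odd k ℤ.* gf (fullRun m) m (n′ k))             ∎

open PartitionSeries

-- Comparison of both sides modulo q^(n+1).

module CrankModulo (n : ℕ) where

  open Modulo (suc n) using (ring; ℤ⟶ring; exact)
  open CommutativeRing ring hiding (ring)
  open Algebra.Properties.Ring (CommutativeRing.ring ring) using (-‿distribˡ-*; -‿involutive)

  factors : InvertibleFactors ring
  factors = record
    { pow       = q^
    ; pow-0     = refl
    ; pow-+     = λ i j → exact (q^-+ i j)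
    ; α         = λ k → recip (𝟙 ⊝ q^ (suc k))
    ; β         = λ k → recip (𝟙 ⊕ q^ (suc k))
    ; α-inverse = λ k → exact (recip-inverse (𝟙 ⊝ q^ (suc k)) ≡.refl)
    ; β-inverse = λ k → exact (recip-inverse (𝟙 ⊕ q^ (suc k)) ≡.refl)
    }

  open FiniteIdentity ring ℤ⟶ring factors
  open Truncated n (λ _ → q^-below)
  open Relation.Binary.Reasoning.Setoid setoid

  poch-Q : ∀ N → poch (q^ 1) N ≈ Q N
  poch-Q zero    = refl
  poch-Q (suc N) = *-cong (+-congˡ {𝟙} (-‿cong {q^ 1 ⊛ q^ N} {q^ (suc N)} (sym {q^ (suc N)} {q^ 1 ⊛ q^ N} (exact (q^-+ 1 N))))) (poch-Q N)

  -- Two signs cancel: 1 - (-q) q^N = 1 + q^(N+1).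
  poch-V : ∀ N → poch (neg (q^ 1)) N ≈ V N
  poch-V zero    = refl
  poch-V (suc N) = *-cong (+-congˡ {𝟙} (begin
    neg (neg (q^ 1) ⊛ q^ N)   ≈⟨ -‿cong (-‿distribˡ-* (q^ 1) (q^ N)) ⟨
    neg (neg (q^ 1 ⊛ q^ N))   ≈⟨ -‿involutive (q^ 1 ⊛ q^ N) ⟩
    q^ 1 ⊛ q^ N               ≈⟨ exact (q^-+ 1 N) ⟨
    q^ (suc N)                ∎)) (poch-V N)

  -- `poch∞` reads coefficient k off the k-th partial product; for k ≤ n stability allows the n-th
  -- instead.
  poch∞-truncated : ∀ z → z 0 ≡ 0ℤ → poch∞ z ≈ poch z n
  poch∞-truncated z z₀ k (ℕ.s≤s k≤n) = ≡.trans (≡.sym (poch-stable z z₀ k (n ∸ k))) (≡.cong (λ N → poch z N k) (ℕ.m∸n+n≡m k≤n))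

  crank≈ : Mₑ-Mₒ ≈ H n * (1# + 4# * ∑ w n)
  crank≈ = begin
    poch∞ (q^ 1) ⊛ r   ≈⟨ *-congʳ {r} (trans (poch∞-truncated (q^ 1) ≡.refl) (poch-Q n)) ⟩
    Q n ⊛ r            ≈⟨ crank-series {r} r-inverse ⟩
    H n * (1# + 4# * ∑ w n) ∎
    where
    V∞ = poch∞ (neg (q^ 1))
    r = recip (V∞ ⊛ V∞)
    V∞≈V : V∞ ≈ V n
    V∞≈V = trans (poch∞-truncated (neg (q^ 1)) ≡.refl) (poch-V n)
    r-inverse : V n * V n * r ≈ 1#
    -- `r` inverts the square of the full product `V∞`, which modulo q^(n+1) is that of `V n`.
    r-inverse = trans (*-congʳ {r} (sym (*-cong V∞≈V V∞≈V))) (exact (recip-inverse (V∞ ⊛ V∞) denominator-constant))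

  sgn≈ : ∀ j → constant (-1ℤ ℤ.^ j) ≈ sgn j
  sgn≈ zero    = exact constant-1
  sgn≈ (suc j) = begin
    constant (-1ℤ ℤ.* -1ℤ ℤ.^ j)   ≡⟨ ≡.cong constant (ℤ.-1*i≡-i (-1ℤ ℤ.^ j)) ⟩
    constant (ℤ.- (-1ℤ ℤ.^ j))     ≈⟨ exact (constant-neg (-1ℤ ℤ.^ j)) ⟩
    neg (constant (-1ℤ ℤ.^ j))     ≈⟨ -‿cong (sgn≈ j) ⟩
    neg (sgn j)                    ∎

  signed4≈ : ∀ j → constant (signed4 j) ≈ 4# * sgn j
  signed4≈ j = trans (exact (constant-* (+ 4) (-1ℤ ℤ.^ j))) (*-cong four (sgn≈ j))
    where
    four : constant (+ 4) ≈ 4#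
    four zero    _ = ≡.refl
    four (suc _) _ = ≡.refl

  B O X Z : ℕ → Series
  B m = gf (fullRun m) m
  O m = gf ω m
  X m = stride always m (O m)
  Z m = stride odd m (B m)

  O≈ : ∀ m → O m ≈ H m * (1# + 4# * ∑ w m)
  O≈ = weight-series B O X Z (full-run-series B (exact (λ { zero → ≡.refl ; (suc _) → ≡.refl })) B-step)
    -- With no parts allowed only the empty partition remains, and its weight is 1.
    (exact (λ { zero → ≡.refl ; (suc _) → ≡.refl }))
    (λ m → trans (exact (gf-ω-suc m)) (+-congˡ {X m} (*-congʳ {Z m} (signed4≈ (suc m)))))
    (λ m → geometric {q^ (suc m)} {X m} {O m} (exact (stride-step₁ {always} m (O m) ≡.refl)))
    (λ m → geometric {q^ (suc m) ⊛ q^ (suc m)} {Z m} {q^ (suc m) ⊛ B m} (Z-step m))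
    where
    B-step : ∀ m → (1# - q^ (suc m)) * B (suc m) ≈ q^ (suc m) * B m
    B-step m = begin
      -- At least one copy of m + 1 means one copy, x, followed by any number of copies, `Y`.
      (1# - x) * B (suc m)    ≈⟨ *-congˡ {1# - x} (trans (exact (gf-fullRun-suc m)) (exact (stride-step₀ {positive} m (B m) ≡.refl))) ⟩
      (1# - x) * (x * Y)      ≈⟨ trans (sym (*-assoc (1# - x) x Y)) (trans (*-congʳ {Y} (*-comm (1# - x) x)) (*-assoc x (1# - x) Y)) ⟩
      x * ((1# - x) * Y)      ≈⟨ *-congˡ {x} (geometric {x} {Y} {B m} (exact (stride-step₁ {always} m (B m) ≡.refl))) ⟩
      x * B m                 ∎
      where
      x = q^ (suc m)
      Y = stride always m (B m)
    Z-step : ∀ m → Z m ≈ q^ (suc m) ⊛ B m ⊕ q^ (suc m) ⊛ q^ (suc m) ⊛ Z m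
    Z-step m = begin
      -- An odd number of copies is one copy, followed by none or by one more and again an odd
      -- number.
      Z m                         ≈⟨ exact (stride-odd m (B m)) ⟩
      x ⊛ (B m ⊕ x ⊛ Z m)         ≈⟨ distribˡ x (B m) (x ⊛ Z m) ⟩
      x ⊛ B m ⊕ x ⊛ (x ⊛ Z m)     ≈⟨ +-congˡ {x ⊛ B m} (*-assoc x x (Z m)) ⟨
      x ⊛ B m ⊕ x ⊛ x ⊛ Z m       ∎
      where x = q^ (suc m)

  crank≈O : Mₑ-Mₒ ≈ O n
  crank≈O = trans crank≈ (sym (O≈ n))

theorem1p6 : (n : ℕ) → 0 < n → Mₑ-Mₒ n ≡ sumℤ (map ω (partitions n))
-- The coefficient of q^n survives modulo q^(n+1), and `O n n` is by definition the weighted sum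
-- over `partitions n`.
theorem1p6 n _ = CrankModulo.crank≈O n n (ℕ.n<1+n n)
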